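{- Let $n\ge4$ be even, let $s$ be an integer with $1\le s\le n$ and $\gcd(s,n)=1$, and let \[ \mathcal{S}_{n,n-2,s}=\bigl\{b_0X+b_1X^{q^s}+(b_1X)^{q^{s(n-1)}}: b_0,b_1\in\mathbb{F}_{q^n}\bigr\}. \] Let $\rho$ be the rank function of the $q$-polymatroid $\mathcal{M}[\mathcal{S}_{n,n-2,s}]$. Then for every nonzero $u$-dimensional $\mathbb{F}_q$-subspace $U$ of $\mathbb{F}_{q^n}$: $\rho(U)=2n$ if $u>2$; $\rho(U)=n$ if $u=1$; and $\rho(U)\in\{2n,2n-1\}$ if $u=2$.
   Context: Each $q^s$-polynomial $f=\sum_{i=0}^{n-1}a_iX^{q^{si}}$ with $a_i\in\mathbb{F}_{q^n}$ defines an $\mathbb{F}_q$-linear map $x\mapsto f(x)$ of $\mathbb{F}_{q^n}$; identifying $\mathbb{F}_{q^n}$ with $\mathbb{F}_q^n$ via a suitable $\mathbb{F}_q$-basis, $\mathcal{S}_{n,n-2,s}$ becomes an $\mathbb{F}_q$-linear space of symmetric $n\times n$ matrices over $\mathbb{F}_q$ (of $\mathbb{F}_q$-dimension $2n$ and minimum rank distance $n-2$). The $q$-polymatroid $\mathcal{M}[\mathcal{C}]$ of such a code is its column $q$-polymatroid; in this polynomial setting its rank function on $\mathbb{F}_q$-subspaces $U\le\mathbb{F}_{q^n}$ is $\rho(U)=\dim_{\mathbb{F}_q}\mathcal{C}-\dim_{\mathbb{F}_q}\{f\in\mathcal{C}: f(x)=0\ \text{for all } x\in U\}$. -}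

module Defs where

open import Level using (0ℓ)
open import Algebra.Bundles using (CommutativeRing)
open import Data.Nat using (ℕ; zero; suc; _^_)
open import Data.Nat.Primality using (Prime)
open import Data.Fin using (Fin)
import Data.Fin as Fin
open import Data.Product using (Σ; ∃; _×_; _,_)
open import Relation.Binary.PropositionalEquality using (_≡_)
open import Relation.Nullary using (¬_)

IsPrimePower : ℕ → Set
IsPrimePower q = Σ ℕ λ p → Σ ℕ λ k → Prime p × q ≡ p ^ suc k

module _ (R : CommutativeRing 0ℓ 0ℓ) where
  open CommutativeRing R

  IsField : Set
  IsField = (¬ (1# ≈ 0#)) × (∀ x → ¬ (x ≈ 0#) → Σ Carrier λ y → x * y ≈ 1#)

  HasCard : ℕ → Set
  HasCard N = Σ (Carrier → Fin N) λ to → Σ (Fin N → Carrier) λ from →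
              (∀ x y → x ≈ y → to x ≡ to y) × (∀ x → from (to x) ≈ x) × (∀ i → to (from i) ≡ i)

  pow : Carrier → ℕ → Carrier
  pow x zero    = 1#
  pow x (suc k) = x * pow x k

  module _ (q : ℕ) where
    -- the subfield F_q = { a | a^q = a } of F_{q^n}
    InFq : Carrier → Set
    InFq a = pow a q ≈ a

    module Span {V : Set} (_≈V_ : V → V → Set) (0V : V) (_+V_ : V → V → V) (_·V_ : Carrier → V → V) where
      lincomb : ∀ {d} → (Fin d → Carrier) → (Fin d → V) → V
      lincomb {zero}  c b = 0V
      lincomb {suc d} c b = (c Fin.zero ·V b Fin.zero) +V lincomb (λ i → c (Fin.suc i)) (λ i → b (Fin.suc i))

      IsSubspace : (V → Set) → Set
      IsSubspace P = (∀ v w → v ≈V w → P v → P w) × P 0V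
                   × (∀ v w → P v → P w → P (v +V w))
                   × (∀ a v → InFq a → P v → P (a ·V v))

      HasDim : (V → Set) → ℕ → Set
      HasDim P d = Σ (Fin d → V) λ b →
          (∀ i → P (b i))
        × (∀ (c : Fin d → Carrier) → (∀ i → InFq (c i)) → lincomb c b ≈V 0V → ∀ i → c i ≈ 0#)
        × (∀ v → P v → Σ (Fin d → Carrier) λ c → (∀ i → InFq (c i)) × lincomb c b ≈V v)

    module SpK = Span _≈_ 0# _+_ _*_

    module SpFun = Span {Carrier → Carrier} (λ f g → ∀ x → f x ≈ g x) (λ _ → 0#)
                        (λ f g x → f x + g x) (λ a f x → a * f x)

    module _ (n s : ℕ) where
      InS : (Carrier → Carrier) → Set
      InS f = Σ Carrier λ b0 → Σ Carrier λ b1 →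
              ∀ x → f x ≈ (b0 * x + b1 * pow x (q ^ s)) + pow (b1 * x) (q ^ (s Data.Nat.* (n Data.Nat.∸ 1)))

      InSVanish : (Carrier → Set) → (Carrier → Carrier) → Set
      InSVanish U f = InS f × (∀ x → U x → f x ≈ 0#)

      IsRank : (Carrier → Set) → ℕ → Set
      IsRank U r = Σ ℕ λ dC → Σ ℕ λ dK →
                   SpFun.HasDim InS dC × SpFun.HasDim (InSVanish U) dK × (r Data.Nat.+ dK ≡ dC)

{-# OPTIONS --safe #-}
-- Write σ x = x^{q^s}; it generates the Galois group, τ = σ⁻¹ = x^{q^{s(n-1)}}, and its fixed field is F_q.
-- If f = b₀X + b₁σ(X) + τ(b₁X) vanishes at v and w, eliminating b₀ leaves τ(b₁δ) = b₁δ with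
-- δ = wσ(v) - vσ(w), i.e. b₁δ ∈ F_q; and δ ≠ 0 exactly when v, w are independent over F_q.  Hence the codewords
-- vanishing on U have F_q-dimension n for u = 1 (b₁ free, b₀ determined) and exactly 1 for u = 2.  Three
-- independent zeros force b₁ = 0, for otherwise the two values of δ would have ratio in F_q; this also makes
-- (b₀, b₁) ↦ f injective, so the code has dimension 2n.
--
-- Dimensions are obtained by counting: a subspace with q^m elements has dimension m.  That F_q has exactly q elements
-- follows from root counting for X^q - X and for the trace polynomial, which kills all x^q - x.

module Submission where

open import Defs
open import Level using (0ℓ)
open import Algebra.Bundles using (CommutativeMonoid; CommutativeRing)
open import Algebra.Module.Bundles using (LeftSemimodule)
import Algebra.Construct.Pointwise as Pointwise
import Algebra.Module.Construct.TensorUnit as TensorUnit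
import Algebra.Properties.CommutativeMonoid.Sum as Sum
import Algebra.Properties.CommutativeSemigroup as CommutativeSemigroupProperties
import Algebra.Properties.CommutativeSemiring.Binomial as Binomial
import Algebra.Properties.CommutativeSemiring.Exp as Exp
import Algebra.Properties.Ring as RingProperties
import Algebra.Properties.Semiring.Mult as Mult
import Algebra.Solver.Ring.NaturalCoefficients.Default as Solver
open import Data.Fin using (Fin; fromℕ; inject₁; punchIn; combine; remQuot; finToFun; funToFin)
open import Data.Fin.Patterns using (0F; 1F; 2F)
open import Data.Fin.Permutation using (permutation)
import Data.Fin.Properties as Fin
open import Data.Nat as ℕ using (ℕ; zero; suc; z≤n; s≤s; _∸_; _!)
import Data.Nat.Properties as ℕ
open import Data.Nat.Combinatorics using (_C_; nCn≡1; nCk≡n!/k![n-k]!; nCk≡nC[n∸k]; k![n∸k]!∣n!)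
open import Data.Nat.Divisibility using (_∣_; divides; ∣1⇒≡1; >⇒∤; m∣m*n)
open import Data.Nat.DivMod using (m/n*n≡m)
open import Data.Nat.GCD using (gcd; GCD; gcd-GCD; module Bézout)
open import Data.Nat.Primality using (Prime; euclidsLemma; ¬prime[0]; ¬prime[1]; prime⇒nonZero; prime⇒nonTrivial)
open import Data.Product using (Σ; ∃; _×_; _,_; proj₁; proj₂)
open import Data.Sum using (_⊎_; inj₁; inj₂)
open import Data.Unit using (⊤; tt)
open import Data.Vec.Functional using (_∷_; replicate)
open import Function using (_∘_)
open import Relation.Binary.Core using (Rel)
open import Relation.Binary.PropositionalEquality as ≡ using (_≡_)
import Relation.Binary.Reasoning.Setoid as SetoidReasoning
open import Relation.Nullary using (¬_; Dec; yes; no; contradiction)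
open import Relation.Nullary.Decidable using (map′; decidable-stable)
open import Relation.Unary using (Decidable)

-- The field is known only through its q^n elements, and F_q only as the solution set of a^q = a. So
-- the characteristic, the additivity of x ↦ x^q and the size of F_q must themselves be derived from
-- counts. `IsRank` asks for bases of the code and of the codewords vanishing on U, and no
-- convenient explicit basis is at hand. Explicit lists are: pairs (b₀, b₁) for the code, and the
-- admissible b₁ alone for the vanishing codewords. One such list gives both a basis and the
-- uniqueness of the dimension. Origin of δ: w f(v) - v f(w) is free of b₀, and since τ undoes σ,
-- what remains is exactly b₁δ - τ(b₁δ). Codewords are functions, not pairs, so listing them by
-- pairs is only legitimate once the field is known to contain three independent elements.

-- Binomial coefficients modulo a prime.

prime∤! : ∀ {p} → Prime p → ∀ {k} → k ℕ.< p → ¬ (p ∣ k !)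
prime∤! pr {zero}  _   p∣1 = ¬prime[1] (≡.subst Prime (∣1⇒≡1 p∣1) pr)
prime∤! pr {suc k} k<p p∣  with euclidsLemma (suc k) (k !) pr p∣
... | inj₁ p∣k  = >⇒∤ k<p p∣k
... | inj₂ p∣k! = prime∤! pr (ℕ.<-trans (ℕ.n<1+n k) k<p) p∣k!

-- p divides p! = (p C k) · k! · (p - k)!, but neither factorial of a smaller number.
prime∣pCk : ∀ {p} → Prime p → ∀ {k} → 0 ℕ.< k → k ℕ.< p → p ∣ p C k
prime∣pCk {p} pr {k} 0<k k<p
  with euclidsLemma (p C k) (k ! ℕ.* (p ∸ k) !) pr p∣product
  where
  instance _ = prime⇒nonZero pr
  k≤p = ℕ.<⇒≤ k<p
  pCk*k![p∸k]!≡p! : (p C k) ℕ.* (k ! ℕ.* (p ∸ k) !) ≡ p !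
  pCk*k![p∸k]!≡p! = ≡.trans (≡.cong (ℕ._* (k ! ℕ.* (p ∸ k) !)) (nCk≡n!/k![n-k]! k≤p))
    (m/n*n≡m ⦃ k ℕ.!* (p ∸ k) !≢0 ⦄ (k![n∸k]!∣n! k≤p))
  n∣n! : ∀ m → .⦃ _ : ℕ.NonZero m ⦄ → m ∣ m !
  n∣n! (suc m) = m∣m*n (m !)
  p∣product = ≡.subst (p ∣_) (≡.sym pCk*k![p∸k]!≡p!) (n∣n! p)
... | inj₁ p∣C = p∣C
... | inj₂ p∣d with euclidsLemma (k !) ((p ∸ k) !) pr p∣d
...   | inj₁ p∣k!     = contradiction p∣k! (prime∤! pr k<p)
...   | inj₂ p∣[p∸k]! = contradiction p∣[p∸k]! (prime∤! pr (ℕ.∸-monoʳ-< {p} 0<k (ℕ.<⇒≤ k<p)))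

-- Finite enumerations and counting on index sets.

-- States that `P` has exactly `c` elements up to `≈`. Only elements are listed, never proofs of
-- `P`, and injectivity lands in `≡` on indices, so that counts reduce to injections between finite
-- index sets.
record Enumeration {A : Set} (_≈_ : Rel A 0ℓ) (P : A → Set) (c : ℕ) : Set where
  field
    elt           : Fin c → A
    elt-∈         : ∀ i → P (elt i)
    elt-injective : ∀ {i j} → elt i ≈ elt j → i ≡ j
    elt-onto      : ∀ x → P x → ∃ λ i → elt i ≈ x

enumerate : ∀ {N} {P : Fin N → Set} → Decidable P → ∃ (Enumeration _≡_ P)
enumerate {zero} P? = 0 , record
  { elt = λ () ; elt-∈ = λ () ; elt-injective = λ { {()} } ; elt-onto = λ () }
enumerate {suc N} {P} P? with enumerate (P? ∘ Fin.suc) | P? 0F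
... | c , e | no ¬P0 = c , record
  { elt           = Fin.suc ∘ E.elt
  ; elt-∈         = E.elt-∈
  ; elt-injective = E.elt-injective ∘ Fin.suc-injective
  ; elt-onto      = λ { 0F P0 → contradiction P0 ¬P0
                      ; (Fin.suc x) Px → proj₁ (E.elt-onto x Px) , ≡.cong Fin.suc (proj₂ (E.elt-onto x Px)) }
  }
  where module E = Enumeration e
... | c , e | yes P0 = suc c , record
  { elt           = elt′
  ; elt-∈         = λ { 0F → P0 ; (Fin.suc i) → E.elt-∈ i }
  ; elt-injective = λ { {0F} {0F} _ → ≡.refl
                      ; {Fin.suc i} {Fin.suc j} eq → ≡.cong Fin.suc (E.elt-injective (Fin.suc-injective eq)) }
  ; elt-onto      = λ { 0F _ → 0F , ≡.refl
                      ; (Fin.suc x) Px → Fin.suc (proj₁ (E.elt-onto x Px)) , ≡.cong Fin.suc (proj₂ (E.elt-onto x Px)) }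
  }
  where
  module E = Enumeration e
  elt′ : Fin (suc c) → Fin (suc N)
  elt′ 0F          = 0F
  elt′ (Fin.suc i) = Fin.suc (E.elt i)

pair-injective⇒≤ : ∀ {N c d} (f : Fin N → Fin c) (g : Fin N → Fin d) →
                   (∀ {i j} → f i ≡ f j → g i ≡ g j → i ≡ j) → N ℕ.≤ c ℕ.* d
pair-injective⇒≤ f g inj = Fin.injective⇒≤ {f = λ i → combine (f i) (g i)} λ {i} {j} eq →
  let f≡ , g≡ = Fin.combine-injective (f i) (g i) (f j) (g j) eq in inj f≡ g≡

funToFin-cong : ∀ {d c} {f g : Fin d → Fin c} → (∀ i → f i ≡ g i) → funToFin f ≡ funToFin g
funToFin-cong {zero}  eq = ≡.refl
funToFin-cong {suc d} eq = ≡.cong₂ combine (eq 0F) (funToFin-cong (eq ∘ Fin.suc))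

-- Laws of powers in a commutative ring.

module Powers (R : CommutativeRing 0ℓ 0ℓ) where
  open CommutativeRing R
  open Exp commutativeSemiring using (_^_; ^-congˡ; ^-assocʳ; ^-distrib-*)

  pow≡^ : ∀ x k → pow R x k ≡ x ^ k
  pow≡^ x zero    = ≡.refl
  pow≡^ x (suc k) = ≡.cong (x *_) (pow≡^ x k)

  pow-cong : ∀ k {x y} → x ≈ y → pow R x k ≈ pow R y k
  pow-cong k {x} {y} x≈y rewrite pow≡^ x k | pow≡^ y k = ^-congˡ k x≈y

  pow-assoc : ∀ x m n → pow R (pow R x m) n ≈ pow R x (m ℕ.* n)
  pow-assoc x m n rewrite pow≡^ x m | pow≡^ (x ^ m) n | pow≡^ x (m ℕ.* n) = ^-assocʳ x m n

  pow-distrib-* : ∀ x y n → pow R (x * y) n ≈ pow R x n * pow R y n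
  pow-distrib-* x y n rewrite pow≡^ (x * y) n | pow≡^ x n | pow≡^ y n = ^-distrib-* x y n

  pow-1# : ∀ k → pow R 1# k ≈ 1#
  pow-1# zero    = refl
  pow-1# (suc k) = trans (*-identityˡ _) (pow-1# k)

-- Finite fields: characteristic, Fermat's theorem, additivity of Frobenius.

module FieldProperties (R : CommutativeRing 0ℓ 0ℓ) (isField : IsField R) where
  open CommutativeRing R
  open Powers R
  open Exp commutativeSemiring using (_^_)
  open Mult semiring using (×-assocˡ; ×1-homo-*; ×-congˡ; ×-assoc-*; ×-congʳ; ×-homo-1) renaming (_×_ to _×ₙ_)
  open RingProperties ring using (+-identityʳ-unique)
  open SetoidReasoning setoid

  1≉0 : ¬ (1# ≈ 0#)
  1≉0 = proj₁ isField

  *-cancelʳ : ∀ {x y z} → ¬ (z ≈ 0#) → x * z ≈ y * z → x ≈ y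
  *-cancelʳ {x} {y} {z} z≉0 xz≈yz with z⁻¹ , zz⁻¹≈1 ← proj₂ isField z z≉0 = begin
    x             ≈⟨ *-identityʳ x ⟨
    x * 1#        ≈⟨ *-congˡ zz⁻¹≈1 ⟨
    x * (z * z⁻¹) ≈⟨ *-assoc x z z⁻¹ ⟨
    x * z * z⁻¹   ≈⟨ *-congʳ xz≈yz ⟩
    y * z * z⁻¹   ≈⟨ *-assoc y z z⁻¹ ⟩
    y * (z * z⁻¹) ≈⟨ *-congˡ zz⁻¹≈1 ⟩
    y * 1#        ≈⟨ *-identityʳ y ⟩
    y             ∎

  *-≉0 : ∀ {x y} → ¬ (x ≈ 0#) → ¬ (y ≈ 0#) → ¬ (x * y ≈ 0#)
  *-≉0 x≉0 y≉0 xy≈0 = x≉0 (*-cancelʳ y≉0 (trans xy≈0 (sym (zeroˡ _))))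

  pow-≉0 : ∀ {x} k → ¬ (x ≈ 0#) → ¬ (pow R x k ≈ 0#)
  pow-≉0 zero    x≉0 = 1≉0
  pow-≉0 (suc k) x≉0 = *-≉0 x≉0 (pow-≉0 k x≉0)

  -- Translation by 1 permutes the field, so it does not change the sum of all elements.
  card×1≈0 : ∀ {N} → HasCard R N → N ×ₙ 1# ≈ 0#
  card×1≈0 {N} (to , from , to-cong , from-to , to-from) = +-identityʳ-unique (sum from) (N ×ₙ 1#) (sym (begin
    sum from                                ≈⟨ sum-permute from π ⟩
    sum (λ i → from (to (from i + 1#)))     ≈⟨ sum-cong-≋ (λ i → from-to (from i + 1#)) ⟩
    sum (λ i → from i + 1#)                 ≈⟨ ∑-distrib-+ from (replicate N 1#) ⟩
    sum from + sum (replicate N 1#)         ≈⟨ +-congˡ (sum-replicate N) ⟩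
    sum from + N ×ₙ 1#                      ∎))
    where
    open Sum +-commutativeMonoid
    π = permutation (λ i → to (from i + 1#)) (λ i → to (from i - 1#))
      (λ i → ≡.trans (to-cong _ _ (begin
        from (to (from i - 1#)) + 1#  ≈⟨ +-congʳ (from-to _) ⟩
        from i - 1# + 1#              ≈⟨ +-assoc _ _ _ ⟩
        from i + (- 1# + 1#)          ≈⟨ +-congˡ (-‿inverseˡ 1#) ⟩
        from i + 0#                   ≈⟨ +-identityʳ _ ⟩
        from i                        ∎)) (to-from i))
      (λ i → ≡.trans (to-cong _ _ (begin
        from (to (from i + 1#)) - 1#  ≈⟨ +-congʳ (from-to _) ⟩
        from i + 1# - 1#              ≈⟨ +-assoc _ _ _ ⟩
        from i + (1# - 1#)            ≈⟨ +-congˡ (-‿inverseʳ 1#) ⟩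
        from i + 0#                   ≈⟨ +-identityʳ _ ⟩
        from i                        ∎)) (to-from i))

  ≈-dec : ∀ {N} → HasCard R N → ∀ x y → Dec (x ≈ y)
  ≈-dec (to , from , to-cong , from-to , to-from) x y = map′
    (λ eq → trans (sym (from-to x)) (trans (reflexive (≡.cong from eq)) (from-to y)))
    (to-cong x y) (to x Fin.≟ to y)

  module Fermat {M : ℕ} (card : HasCard R (suc M)) (x : Carrier) (x≉0 : ¬ (x ≈ 0#)) where
    open Sum *-commutativeMonoid
    to      = proj₁ card
    from    = proj₁ (proj₂ card)
    to-cong = proj₁ (proj₂ (proj₂ card))
    from-to = proj₁ (proj₂ (proj₂ (proj₂ card)))
    to-from = proj₂ (proj₂ (proj₂ (proj₂ card)))
    x⁻¹     = proj₁ (proj₂ isField x x≉0)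
    i₀      = to 0#

    -- Replacing 0 by 1 turns the product of the nonzero elements into a product over all indices,
    -- on which multiplication by `x` acts as a permutation. As the monoid opened here is
    -- multiplicative, `sum` denotes a product.
    unitPart : Carrier → Carrier
    unitPart y with ≈-dec card y 0#
    ... | yes _ = 1#
    ... | no  _ = y

    unitPart-0 : ∀ {y} → y ≈ 0# → unitPart y ≈ 1#
    unitPart-0 {y} y≈0 with ≈-dec card y 0#
    ... | yes _   = refl
    ... | no  y≉0 = contradiction y≈0 y≉0

    unitPart-≉0 : ∀ {y} → ¬ (y ≈ 0#) → unitPart y ≈ y
    unitPart-≉0 {y} y≉0 with ≈-dec card y 0#
    ... | yes y≈0 = contradiction y≈0 y≉0
    ... | no  _   = refl

    unitPart-cong : ∀ {y z} → y ≈ z → unitPart y ≈ unitPart z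
    unitPart-cong {y} {z} y≈z with ≈-dec card y 0# | ≈-dec card z 0#
    ... | yes _   | yes _   = refl
    ... | yes y≈0 | no  z≉0 = contradiction (trans (sym y≈z) y≈0) z≉0
    ... | no  y≉0 | yes z≈0 = contradiction (trans y≈z z≈0) y≉0
    ... | no  _   | no  _   = y≈z

    units : Fin M → Carrier
    units j = from (punchIn i₀ j)

    units-≉0 : ∀ j → ¬ (units j ≈ 0#)
    units-≉0 j eq = Fin.punchInᵢ≢i i₀ j (≡.trans (≡.sym (to-from _)) (to-cong _ _ eq))

    sum-≉0 : ∀ {k} (f : Fin k → Carrier) → (∀ i → ¬ (f i ≈ 0#)) → ¬ (sum f ≈ 0#)
    sum-≉0 {zero}  f f≉0 = 1≉0
    sum-≉0 {suc k} f f≉0 = *-≉0 (f≉0 0F) (sum-≉0 (f ∘ Fin.suc) (f≉0 ∘ Fin.suc))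

    x⁻¹x≈1 : x⁻¹ * x ≈ 1#
    x⁻¹x≈1 = trans (*-comm _ _) (proj₂ (proj₂ isField x x≉0))

    inverse-perm : ∀ a b → a * b ≈ 1# → ∀ i → to (a * from (to (b * from i))) ≡ i
    inverse-perm a b ab≈1 i = ≡.trans (to-cong _ _ (begin
      a * from (to (b * from i)) ≈⟨ *-congˡ (from-to _) ⟩
      a * (b * from i)           ≈⟨ *-assoc a b _ ⟨
      a * b * from i             ≈⟨ *-congʳ ab≈1 ⟩
      1# * from i                ≈⟨ *-identityˡ _ ⟩
      from i                     ∎)) (to-from i)

    π = permutation (λ i → to (x * from i)) (λ i → to (x⁻¹ * from i))
          (inverse-perm x x⁻¹ (proj₂ (proj₂ isField x x≉0))) (inverse-perm x⁻¹ x x⁻¹x≈1)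

    unit-product : ∀ {y} → ¬ (y ≈ 0#) → sum (λ i → unitPart (y * from i)) ≈ sum (λ j → y * units j)
    unit-product {y} y≉0 = begin
      sum (λ i → unitPart (y * from i))
        ≈⟨ sum-remove {i = i₀} (λ i → unitPart (y * from i)) ⟩
      unitPart (y * from i₀) * sum (λ j → unitPart (y * units j))
        ≈⟨ *-cong (unitPart-0 (trans (*-congˡ (from-to 0#)) (zeroʳ y)))
                  (sum-cong-≋ (λ j → unitPart-≉0 (*-≉0 y≉0 (units-≉0 j)))) ⟩
      1# * sum (λ j → y * units j)
        ≈⟨ *-identityˡ _ ⟩
      sum (λ j → y * units j) ∎

    -- Multiplication by `x` permutes the M nonzero elements, so their product is unchanged when
    -- multiplied by x^M, and it can be cancelled.
    x^M≈1 : pow R x M ≈ 1#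
    x^M≈1 = *-cancelʳ (sum-≉0 units units-≉0) (begin
      pow R x M * sum units                          ≡⟨ ≡.cong (_* sum units) (pow≡^ x M) ⟩
      x ^ M * sum units                              ≈⟨ *-congʳ (sum-replicate M) ⟨
      sum (replicate M x) * sum units                ≈⟨ ∑-distrib-+ (replicate M x) units ⟨
      sum (λ j → x * units j)                        ≈⟨ unit-product x≉0 ⟨
      sum (λ i → unitPart (x * from i))              ≈⟨ sum-cong-≋ (λ i → unitPart-cong (trans (*-identityˡ _) (from-to (x * from i)))) ⟨
      -- The factor `1#` brings the permuted product into the form of `unit-product` at y = 1.
      sum (λ i → unitPart (1# * from (to (x * from i)))) ≈⟨ sum-permute (λ i → unitPart (1# * from i)) π ⟨
      sum (λ i → unitPart (1# * from i))             ≈⟨ unit-product 1≉0 ⟩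
      sum (λ j → 1# * units j)                       ≈⟨ sum-cong-≋ (λ j → *-identityˡ (units j)) ⟩
      sum units                                      ≈⟨ *-identityˡ _ ⟨
      1# * sum units                                 ∎)

  pow-card : ∀ {N} → HasCard R N → ∀ x → pow R x N ≈ x
  pow-card {zero}  card x with () ← proj₁ card x
  pow-card {suc M} card x with ≈-dec card x 0#
  ... | yes x≈0 = trans (*-congʳ x≈0) (trans (zeroˡ _) (sym x≈0))
  ... | no  x≉0 = trans (*-congˡ (Fermat.x^M≈1 card x x≉0)) (*-identityʳ x)

  -- p^m times 1 is the m-th power of p times 1, and a field has no nilpotent elements except 0.
  prime-char : ∀ {p} m → (p ℕ.^ m) ×ₙ 1# ≈ 0# → (∀ x y → Dec (x ≈ y)) → p ×ₙ 1# ≈ 0#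
  prime-char {p} m p^m≈0 _≟_ with (p ×ₙ 1#) ≟ 0#
  ... | yes p≈0 = p≈0
  ... | no  p≉0 = contradiction (trans (sym (×1-homo-pow m)) p^m≈0) (pow-≉0 m p≉0)
    where
    ×1-homo-pow : ∀ m → (p ℕ.^ m) ×ₙ 1# ≈ pow R (p ×ₙ 1#) m
    ×1-homo-pow zero    = +-identityʳ 1#
    ×1-homo-pow (suc m) = trans (×1-homo-* p (p ℕ.^ m)) (*-congˡ (×1-homo-pow m))

  module Frobenius {p : ℕ} (pr : Prime p) (p≈0 : p ×ₙ 1# ≈ 0#) where

    multiple≈0 : ∀ {c} → p ∣ c → ∀ x → c ×ₙ x ≈ 0#
    multiple≈0 {c} (divides k ≡.refl) x = begin
      (k ℕ.* p) ×ₙ x        ≡⟨ ≡.cong (_×ₙ x) (ℕ.*-comm k p) ⟩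
      (p ℕ.* k) ×ₙ x        ≈⟨ ×-assocˡ x p k ⟨
      p ×ₙ (k ×ₙ x)         ≈⟨ ×-congʳ p (*-identityˡ _) ⟨
      p ×ₙ (1# * (k ×ₙ x))  ≈⟨ ×-assoc-* p 1# _ ⟨
      (p ×ₙ 1#) * (k ×ₙ x)  ≈⟨ *-congʳ p≈0 ⟩
      0# * (k ×ₙ x)         ≈⟨ zeroˡ _ ⟩
      0#                    ∎

    pow-prime-+ : ∀ x y → pow R (x + y) p ≈ pow R x p + pow R y p
    pow-prime-+ x y = helper p ≡.refl
      where
      open Sum +-commutativeMonoid
      open Binomial commutativeSemiring
      helper : ∀ p′ → p′ ≡ p → pow R (x + y) p′ ≈ pow R x p′ + pow R y p′
      helper zero     ≡.refl = contradiction pr ¬prime[0]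
      helper (suc p′) ≡.refl = begin
        pow R (x + y) p                   ≡⟨ pow≡^ (x + y) p ⟩
        (x + y) ^ p                       ≈⟨ theorem p x y ⟩
        t 0F + sum (t ∘ Fin.suc)          ≈⟨ +-congˡ (sum-init-last (t ∘ Fin.suc)) ⟩
        t 0F + (sum (λ i → t (Fin.suc (inject₁ i))) + t (Fin.suc (fromℕ p′)))
          ≈⟨ +-cong t-first (+-cong (trans (sum-cong-≋ t-mid) (sum-replicate-zero p′)) t-last) ⟩
        y ^ p + (0# + x ^ p)              ≈⟨ +-congˡ (+-identityˡ _) ⟩
        y ^ p + x ^ p                     ≈⟨ +-comm _ _ ⟩
        x ^ p + y ^ p                     ≡⟨ ≡.cong₂ _+_ (pow≡^ x p) (pow≡^ y p) ⟨
        pow R x p + pow R y p             ∎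
        where
        t = binomialTerm x y p
        t-mid : ∀ i → t (Fin.suc (inject₁ i)) ≈ 0#
        t-mid i = multiple≈0 (prime∣pCk pr (s≤s z≤n)
          (s≤s (≡.subst (ℕ._< p′) (≡.sym (Fin.toℕ-inject₁ i)) (Fin.toℕ<n i)))) _
        t-first : t 0F ≈ y ^ p
        t-first = begin
          (p C 0) ×ₙ (1# * y ^ p)  ≈⟨ ×-congˡ (≡.trans (nCk≡nC[n∸k] {0} {p} z≤n) (nCn≡1 p)) ⟩
          1 ×ₙ (1# * y ^ p)        ≈⟨ ×-homo-1 _ ⟩
          1# * y ^ p               ≈⟨ *-identityˡ _ ⟩
          y ^ p                    ∎
        t-last : t (Fin.suc (fromℕ p′)) ≈ x ^ p
        t-last rewrite Fin.toℕ-fromℕ p′ = begin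
          (p C p) ×ₙ (x ^ p * y ^ (p ∸ p))  ≈⟨ ×-congˡ (nCn≡1 p) ⟩
          1 ×ₙ (x ^ p * y ^ (p ∸ p))        ≈⟨ ×-homo-1 _ ⟩
          x ^ p * y ^ (p ∸ p)               ≡⟨ ≡.cong (λ k → x ^ p * y ^ k) (ℕ.n∸n≡0 p) ⟩
          x ^ p * 1#                        ≈⟨ *-identityʳ _ ⟩
          x ^ p                             ∎

    pow-primePower-+ : ∀ k x y → pow R (x + y) (p ℕ.^ k) ≈ pow R x (p ℕ.^ k) + pow R y (p ℕ.^ k)
    pow-primePower-+ zero    x y = trans (*-identityʳ _) (+-cong (sym (*-identityʳ x)) (sym (*-identityʳ y)))
    pow-primePower-+ (suc k) x y = begin
      pow R (x + y) (p ℕ.* p ℕ.^ k)                 ≈⟨ pow-assoc (x + y) p (p ℕ.^ k) ⟨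
      pow R (pow R (x + y) p) (p ℕ.^ k)             ≈⟨ pow-cong (p ℕ.^ k) (pow-prime-+ x y) ⟩
      pow R (pow R x p + pow R y p) (p ℕ.^ k)       ≈⟨ pow-primePower-+ k _ _ ⟩
      pow R (pow R x p) (p ℕ.^ k) + pow R (pow R y p) (p ℕ.^ k)
        ≈⟨ +-cong (pow-assoc x p (p ℕ.^ k)) (pow-assoc y p (p ℕ.^ k)) ⟩
      pow R x (p ℕ.* p ℕ.^ k) + pow R y (p ℕ.* p ℕ.^ k) ∎

  -- Polynomial functions and the bound on the number of roots.

  -- HasLead d c f: f is a polynomial function of degree at most d with coefficient c at x^d
  -- (c may be zero), in Horner form.
  data HasLead : ℕ → Carrier → (Carrier → Carrier) → Set where
    constant : ∀ {c f} → (∀ x → f x ≈ c) → HasLead 0 c f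
    horner   : ∀ {d c f} a g → HasLead d c g → (∀ x → f x ≈ a + x * g x) → HasLead (suc d) c f

  open Solver commutativeSemiring using (solve; _:+_; _:*_; _:=_)

  lead-resp : ∀ {d c c′ f f′} → c ≈ c′ → (∀ x → f′ x ≈ f x) → HasLead d c f → HasLead d c′ f′
  lead-resp c≈ f≈ (constant F)      = constant (λ x → trans (f≈ x) (trans (F x) c≈))
  lead-resp c≈ f≈ (horner a g G eq) = horner a g (lead-resp c≈ (λ _ → refl) G) (λ x → trans (f≈ x) (eq x))

  lead-+ : ∀ {d c c′ f f′} → HasLead d c f → HasLead d c′ f′ → HasLead d (c + c′) (λ x → f x + f′ x)
  lead-+ (constant F)      (constant F′)         = constant (λ x → +-cong (F x) (F′ x))
  lead-+ (horner a g G eq) (horner a′ g′ G′ eq′) = horner (a + a′) (λ x → g x + g′ x) (lead-+ G G′) λ x →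
    trans (+-cong (eq x) (eq′ x))
      (solve 5 (λ a a′ x g g′ → (a :+ x :* g) :+ (a′ :+ x :* g′) := (a :+ a′) :+ x :* (g :+ g′)) refl a a′ x (g x) (g′ x))

  lead-* : ∀ {d c f} r → HasLead d c f → HasLead d (r * c) (λ x → r * f x)
  lead-* r (constant F)      = constant (λ x → *-congˡ (F x))
  lead-* r (horner a g G eq) = horner (r * a) (λ x → r * g x) (lead-* r G) λ x →
    trans (*-congˡ (eq x)) (solve 4 (λ r a x g → r :* (a :+ x :* g) := r :* a :+ x :* (r :* g)) refl r a x (g x))

  lead-suc : ∀ {d c f} → HasLead d c f → HasLead (suc d) 0# f
  lead-suc {c = c} (constant F) = horner c (λ _ → 0#) (constant (λ _ → refl)) λ x →
    trans (F x) (sym (trans (+-congˡ (zeroʳ x)) (+-identityʳ c)))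
  lead-suc (horner a g G eq) = horner a g (lead-suc G) eq

  lead-< : ∀ {d d′ c f} → d ℕ.< d′ → HasLead d c f → HasLead d′ 0# f
  lead-< {d} {f = f} d<d′ F with j , ≡.refl ← ℕ.m≤n⇒∃[o]m+o≡n d<d′ =
    ≡.subst (λ k → HasLead k 0# f) (ℕ.+-comm j (suc d)) (raise j)
    where
    raise : ∀ j → HasLead (j ℕ.+ suc d) 0# f
    raise zero    = lead-suc F
    raise (suc j) = lead-suc (raise j)

  lead-pow : ∀ d → HasLead d 1# (λ x → pow R x d)
  lead-pow zero    = constant (λ _ → refl)
  lead-pow (suc d) = horner 0# (λ x → pow R x d) (lead-pow d) (λ x → sym (+-identityˡ _))

  -- f x - f r ≈ (x - r) h x, with both sides rearranged to avoid subtraction.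
  divide : ∀ {d c f} → HasLead (suc d) c f → ∀ r →
           Σ (Carrier → Carrier) λ h → HasLead d c h × (∀ x → f x + r * h x ≈ f r + x * h x)
  divide {c = c} {f} (horner a g (constant G) eq) r = (λ _ → c) , constant (λ _ → refl) , λ x → begin
    f x + r * c           ≈⟨ +-congʳ (trans (eq x) (+-congˡ (*-congˡ (G x)))) ⟩
    (a + x * c) + r * c   ≈⟨ solve 3 (λ a b d → (a :+ b) :+ d := (a :+ d) :+ b) refl a (x * c) (r * c) ⟩
    (a + r * c) + x * c   ≈⟨ +-congʳ (trans (eq r) (+-congˡ (*-congˡ (G r)))) ⟨
    f r + x * c           ∎
  divide {c = c} {f} (horner a g G@(horner _ _ _ _) eq) r with h , H , eqh ← divide G r =
      (λ x → g x + r * h x)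
    , lead-resp (+-identityʳ c) (λ _ → refl) (lead-+ G (lead-suc (lead-* r H)))
    , λ x → begin
    f x + r * (g x + r * h x)           ≈⟨ +-cong (eq x) (*-congˡ (eqh x)) ⟩
    (a + x * g x) + r * (g r + x * h x)
      ≈⟨ solve 6 (λ a x r gx gr hx → (a :+ x :* gx) :+ r :* (gr :+ x :* hx) := (a :+ r :* gr) :+ x :* (gx :+ r :* hx))
           refl a x r (g x) (g r) (h x) ⟩
    (a + r * g r) + x * (g x + r * h x) ≈⟨ +-congʳ (eq r) ⟨
    f r + x * (g x + r * h x)           ∎

  -- Dividing off the first root keeps the leading coefficient. At any other root y the identity of
  -- `divide` becomes r 0 · h y = y · h y, so y is a root of the quotient h.
  roots-≤-degree : (∀ x y → Dec (x ≈ y)) → ∀ {m d c f} → HasLead d c f → ¬ (c ≈ 0#) →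
    (r : Fin m → Carrier) → (∀ {i j} → r i ≈ r j → i ≡ j) → (∀ i → f (r i) ≈ 0#) → m ℕ.≤ d
  roots-≤-degree _≟_ {zero}  F c≉0 r inj root = z≤n
  roots-≤-degree _≟_ {suc m} (constant F) c≉0 r inj root = contradiction (trans (sym (F (r 0F))) (root 0F)) c≉0
  roots-≤-degree _≟_ {suc m} F@(horner _ _ _ _) c≉0 r inj root with h , H , eq ← divide F (r 0F) =
    s≤s (roots-≤-degree _≟_ H c≉0 (r ∘ Fin.suc) (Fin.suc-injective ∘ inj) h-root)
    where
    h-root : ∀ i → h (r (Fin.suc i)) ≈ 0#
    h-root i with h (r (Fin.suc i)) ≟ 0#
    ... | yes h≈0 = h≈0
    ... | no  h≉0 = contradiction (inj (*-cancelʳ h≉0 (begin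
      r 0F * h (r (Fin.suc i))                        ≈⟨ +-identityˡ _ ⟨
      0# + r 0F * h (r (Fin.suc i))                   ≈⟨ +-congʳ (root (Fin.suc i)) ⟨
      _                                               ≈⟨ eq (r (Fin.suc i)) ⟩
      _                                               ≈⟨ +-congʳ (root 0F) ⟩
      0# + r (Fin.suc i) * h (r (Fin.suc i))          ≈⟨ +-identityˡ _ ⟩
      r (Fin.suc i) * h (r (Fin.suc i))               ∎))) λ ()

  -- The ring solver works over commutative semirings. Identities with minus signs are therefore
  -- proved with the negative terms moved across, and `subtract` and `transpose` convert between the
  -- two forms.
  subtract : ∀ {a b c} → a ≈ c + b → a - b ≈ c
  subtract {a} {b} {c} eq = begin
    a - b       ≈⟨ +-congʳ eq ⟩
    c + b - b   ≈⟨ +-assoc c b _ ⟩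
    c + (b - b) ≈⟨ +-congˡ (-‿inverseʳ b) ⟩
    c + 0#      ≈⟨ +-identityʳ c ⟩
    c           ∎

  transpose : ∀ {a b c} → a - b ≈ c → a ≈ c + b
  transpose {a} {b} {c} eq = begin
    a             ≈⟨ +-identityʳ a ⟨
    a + 0#        ≈⟨ +-congˡ (-‿inverseˡ b) ⟨
    a + (- b + b) ≈⟨ +-assoc a _ b ⟨
    a - b + b     ≈⟨ +-congʳ eq ⟩
    c + b         ∎

-- The powers of Frobenius, their fixed field F_q, and its size.

module FieldExtension (R : CommutativeRing 0ℓ 0ℓ) (isField : IsField R) (q : ℕ) (q-primePower : IsPrimePower q) (n′ : ℕ)
                      (card : HasCard R (q ℕ.^ suc n′)) where
  open CommutativeRing R
  open Powers R
  open FieldProperties R isField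
  open RingProperties ring using (+-identityʳ-unique; +-inverseʳ-unique; +-cancelʳ; -1*x≈-x)
  open Solver commutativeSemiring using (solve; _:+_; _:=_)
  open SetoidReasoning setoid

  n p e : ℕ
  n = suc n′
  p = proj₁ q-primePower
  e = proj₁ (proj₂ q-primePower)

  pr : Prime p
  pr = proj₁ (proj₂ (proj₂ q-primePower))

  q≡p^ : q ≡ p ℕ.^ suc e
  q≡p^ = proj₂ (proj₂ (proj₂ q-primePower))

  to      = proj₁ card
  from    = proj₁ (proj₂ card)
  to-cong = proj₁ (proj₂ (proj₂ card))
  from-to = proj₁ (proj₂ (proj₂ (proj₂ card)))
  to-from = proj₂ (proj₂ (proj₂ (proj₂ card)))

  infix 4 _≟_
  _≟_ : ∀ x y → Dec (x ≈ y)
  _≟_ = ≈-dec card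

  p^≡q^ : ∀ k → p ℕ.^ (suc e ℕ.* k) ≡ q ℕ.^ k
  p^≡q^ k = ≡.trans (≡.sym (ℕ.^-*-assoc p (suc e) k)) (≡.cong (ℕ._^ k) (≡.sym q≡p^))

  p×1≈0 : Mult._×_ semiring p 1# ≈ 0#
  p×1≈0 = prime-char {p} (suc e ℕ.* n)
    (trans (reflexive (≡.cong (λ k → Mult._×_ semiring k 1#) (p^≡q^ n))) (card×1≈0 card)) _≟_

  open Frobenius pr p×1≈0

  1<q : 1 ℕ.< q
  1<q = ≡.subst (1 ℕ.<_) (≡.sym q≡p^) (ℕ.<-≤-trans (ℕ.nonTrivial⇒n>1 p) (ℕ.m≤m*n p (p ℕ.^ e)))
    where instance
    _ = prime⇒nonTrivial pr
    _ = prime⇒nonZero pr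
    _ = ℕ.m^n≢0 p e

  instance
    q-nonZero : ℕ.NonZero q
    q-nonZero = ℕ.>-nonZero (ℕ.<-trans (s≤s z≤n) 1<q)

  φ : ℕ → Carrier → Carrier
  φ k x = pow R x (q ℕ.^ k)

  φ-cong : ∀ k {x y} → x ≈ y → φ k x ≈ φ k y
  φ-cong k = pow-cong (q ℕ.^ k)

  φ-+ : ∀ k x y → φ k (x + y) ≈ φ k x + φ k y
  φ-+ k x y = ≡.subst (λ j → pow R (x + y) j ≈ pow R x j + pow R y j) (p^≡q^ k) (pow-primePower-+ (suc e ℕ.* k) x y)

  φ-* : ∀ k x y → φ k (x * y) ≈ φ k x * φ k y
  φ-* k x y = pow-distrib-* x y (q ℕ.^ k)

  φ-0# : ∀ k → φ k 0# ≈ 0#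
  φ-0# k = +-identityʳ-unique (φ k 0#) (φ k 0#) (trans (sym (φ-+ k 0# 0#)) (φ-cong k (+-identityʳ 0#)))

  φ-neg : ∀ k x → φ k (- x) ≈ - φ k x
  φ-neg k x = +-inverseʳ-unique (φ k x) (φ k (- x))
    (trans (sym (φ-+ k x (- x))) (trans (φ-cong k (-‿inverseʳ x)) (φ-0# k)))

  φ-∘ : ∀ a b x → φ b (φ a x) ≈ φ (a ℕ.+ b) x
  φ-∘ a b x = trans (pow-assoc x (q ℕ.^ a) (q ℕ.^ b)) (reflexive (≡.cong (pow R x) (≡.sym (ℕ.^-distribˡ-+-* q a b))))

  φ-n : ∀ x → φ n x ≈ x
  φ-n = pow-card card

  φ1≡pow : ∀ x → φ 1 x ≡ pow R x q
  φ1≡pow x = ≡.cong (pow R x) (ℕ.*-identityʳ q)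

  φ-multiple : ∀ {x} a → φ a x ≈ x → ∀ k → φ (k ℕ.* a) x ≈ x
  φ-multiple {x} a fix zero    = *-identityʳ x
  φ-multiple {x} a fix (suc k) = trans (sym (φ-∘ a (k ℕ.* a) x)) (trans (φ-cong (k ℕ.* a) fix) (φ-multiple a fix k))

  Fq : Carrier → Set
  Fq = InFq R q

  Fq⇒φ-fixed : ∀ {a} → Fq a → ∀ k → φ k a ≈ a
  Fq⇒φ-fixed {a} a∈F k = trans (reflexive (≡.cong (λ j → φ j a) (≡.sym (ℕ.*-identityʳ k))))
    (φ-multiple 1 (trans (reflexive (φ1≡pow a)) a∈F) k)

  φ1-fixed⇒Fq : ∀ {a} → φ 1 a ≈ a → Fq a
  φ1-fixed⇒Fq {a} = trans (reflexive (≡.sym (φ1≡pow a)))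

  consecutive-fixed⇒Fq : ∀ {x} a → φ a x ≈ x → ∀ {b} → φ b x ≈ x → 1 ℕ.+ a ≡ b → Fq x
  consecutive-fixed⇒Fq {x} a fixa fixb ≡.refl = φ1-fixed⇒Fq (begin
    φ 1 x         ≈⟨ φ-cong 1 fixa ⟨
    φ 1 (φ a x)   ≈⟨ φ-∘ a 1 x ⟩
    φ (a ℕ.+ 1) x ≡⟨ ≡.cong (λ j → φ j x) (ℕ.+-comm a 1) ⟩
    φ (1 ℕ.+ a) x ≈⟨ fixb ⟩
    x             ∎)

  -- Bézout gives a multiple of s and a multiple of n that differ by 1. Both powers of Frobenius fix
  -- `x`, hence so does the first power; the two cases tell which multiple is larger.
  φ-fixed⇒Fq : ∀ {s x} → gcd s n ≡ 1 → φ s x ≈ x → Fq x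
  φ-fixed⇒Fq {s} {x} gcd≡1 fix with Bézout.identity (≡.subst (GCD s n) gcd≡1 (gcd-GCD s n))
  ... | Bézout.+- k l eq = consecutive-fixed⇒Fq (l ℕ.* n) (φ-multiple n (φ-n x) l) (φ-multiple s fix k) eq
  ... | Bézout.-+ k l eq = consecutive-fixed⇒Fq (k ℕ.* s) (φ-multiple s fix k) (φ-multiple n (φ-n x) l) eq

  Fq-resp : ∀ {a b} → a ≈ b → Fq a → Fq b
  Fq-resp a≈b a∈F = trans (pow-cong q (sym a≈b)) (trans a∈F a≈b)

  Fq-+ : ∀ {a b} → Fq a → Fq b → Fq (a + b)
  Fq-+ {a} {b} a∈F b∈F = φ1-fixed⇒Fq (trans (φ-+ 1 a b) (+-cong (Fq⇒φ-fixed a∈F 1) (Fq⇒φ-fixed b∈F 1)))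

  Fq-* : ∀ {a b} → Fq a → Fq b → Fq (a * b)
  Fq-* {a} {b} a∈F b∈F = trans (pow-distrib-* a b q) (*-cong a∈F b∈F)

  Fq-neg : ∀ {a} → Fq a → Fq (- a)
  Fq-neg {a} a∈F = φ1-fixed⇒Fq (trans (φ-neg 1 a) (-‿cong (Fq⇒φ-fixed a∈F 1)))

  Fq-0 : Fq 0#
  Fq-0 = φ1-fixed⇒Fq (φ-0# 1)

  Fq-1 : Fq 1#
  Fq-1 = pow-1# q

  Fq-inverse : ∀ {a b} → ¬ (a ≈ 0#) → a * b ≈ 1# → Fq a → Fq b
  Fq-inverse {a} {b} a≉0 ab≈1 a∈F = *-cancelʳ a≉0 (begin
    pow R b q * a         ≈⟨ *-congˡ a∈F ⟨
    pow R b q * pow R a q ≈⟨ pow-distrib-* b a q ⟨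
    pow R (b * a) q       ≈⟨ pow-cong q (trans (*-comm b a) ab≈1) ⟩
    pow R 1# q            ≈⟨ pow-1# q ⟩
    1#                    ≈⟨ trans (*-comm b a) ab≈1 ⟨
    b * a                 ∎)

  -- `Tr n` is the trace down to F_q; the shorter sums serve the inductions on its degree and on the
  -- telescoping.
  Tr : ℕ → Carrier → Carrier
  Tr zero    x = 0#
  Tr (suc k) x = φ k x + Tr k x

  -- The powers q^k grow strictly, so every earlier summand lies below the top one. For k = 0 the
  -- zero function is padded to degree 1 = q^0.
  Tr-lead : ∀ k → HasLead (q ℕ.^ k) 1# (Tr (suc k))
  Tr-lead k = lead-resp (+-identityʳ 1#) (λ _ → refl) (lead-+ (lead-pow (q ℕ.^ k)) (low k))
    where
    low : ∀ k → HasLead (q ℕ.^ k) 0# (Tr k)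
    low zero    = lead-suc (constant (λ _ → refl))
    low (suc k) = lead-< (ℕ.^-monoʳ-< q 1<q (ℕ.n<1+n k)) (Tr-lead k)

  T : Carrier → Carrier
  T x = φ 1 x - x

  -- The sum telescopes: φ i (T x) is the difference of φ (i + 1) x and φ i x. Keeping `x` on the
  -- left avoids a subtraction.
  Tr∘T : ∀ k x → Tr k (T x) + x ≈ φ k x
  Tr∘T zero    x = trans (+-identityˡ x) (sym (*-identityʳ x))
  Tr∘T (suc k) x = begin
    φ k (T x) + Tr k (T x) + x    ≈⟨ +-assoc _ _ _ ⟩
    φ k (T x) + (Tr k (T x) + x)  ≈⟨ +-congˡ (Tr∘T k x) ⟩
    φ k (T x) + φ k x             ≈⟨ φ-+ k (T x) x ⟨
    φ k (T x + x)                 ≈⟨ φ-cong k (sym (transpose refl)) ⟩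
    φ k (φ 1 x)                   ≈⟨ φ-∘ 1 k x ⟩
    φ (suc k) x                   ∎

  Tr[Tx]≈0 : ∀ x → Tr n (T x) ≈ 0#
  Tr[Tx]≈0 x = +-cancelʳ x _ _ (trans (Tr∘T n x) (trans (φ-n x) (sym (+-identityˡ x))))

  T-equal⇒Fq : ∀ {x y} → T x ≈ T y → Fq (x - y)
  T-equal⇒Fq {x} {y} Tx≈Ty = φ1-fixed⇒Fq (begin
    φ 1 (x - y)           ≈⟨ φ-+ 1 x (- y) ⟩
    φ 1 x + φ 1 (- y)     ≈⟨ +-congˡ (φ-neg 1 y) ⟩
    φ 1 x - φ 1 y         ≈⟨ subtract (begin
      φ 1 x                 ≈⟨ transpose Tx≈Ty ⟩
      φ 1 y - y + x         ≈⟨ solve 3 (λ a b c → a :+ b :+ c := c :+ b :+ a) refl (φ 1 y) (- y) x ⟩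
      x - y + φ 1 y         ∎) ⟩
    x - y                 ∎)

  enumerateSubset : ∀ {P : Carrier → Set} → (∀ {x y} → x ≈ y → P x → P y) → Decidable P → ∃ (Enumeration _≈_ P)
  enumerateSubset {P} resp P? with c , E ← enumerate (P? ∘ from) = c , record
    { elt           = from ∘ elt
    ; elt-∈         = elt-∈
    ; elt-injective = λ {i} {j} eq → elt-injective (≡.trans (≡.sym (to-from _)) (≡.trans (to-cong _ _ eq) (to-from _)))
    ; elt-onto      = λ x Px → let i , eq = elt-onto (to x) (resp (sym (from-to x)) Px)
                               in i , trans (reflexive (≡.cong from eq)) (from-to x)
    }
    where open Enumeration E

  -- T is additive with kernel Fq and image among the roots of Tr n, so x ↦ (x - (a chosen preimage of T x), T x)
  -- embeds the field in Fq × roots of Tr n.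
  abstract
    Fq-enumeration : Enumeration _≈_ Fq q
    Fq-enumeration with enumerateSubset Fq-resp (λ x → pow R x q ≟ x)
       | enumerateSubset {λ x → Tr n x ≈ 0#} (λ x≈y → trans (sym (Tr-cong n x≈y))) (λ x → Tr n x ≟ 0#)
      where
      Tr-cong : ∀ k {x y} → x ≈ y → Tr k x ≈ Tr k y
      Tr-cong zero    x≈y = refl
      Tr-cong (suc k) x≈y = +-cong (φ-cong k x≈y) (Tr-cong k x≈y)
    ... | c , F | d , Z = ≡.subst (Enumeration _≈_ Fq) (ℕ.≤-antisym c≤q q≤c) F
      where
      module F = Enumeration F
      module Z = Enumeration Z

      c≤q : c ℕ.≤ q
      c≤q = roots-≤-degree _≟_
        (lead-resp (+-identityʳ 1#) (λ _ → refl)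
          (lead-+ (lead-pow q) (lead-resp (zeroʳ _) (λ _ → refl) (lead-* (- 1#) (lead-< 1<q (lead-pow 1))))))
        1≉0 F.elt F.elt-injective λ i → begin
          pow R (F.elt i) q + - 1# * (F.elt i * 1#) ≈⟨ +-cong (F.elt-∈ i) (trans (-1*x≈-x _) (-‿cong (*-identityʳ _))) ⟩
          F.elt i - F.elt i                         ≈⟨ -‿inverseʳ _ ⟩
          0#                                        ∎

      -- The trace has degree q^(n-1), so q^n ≤ c · d leaves at least q elements for F_q.
      d≤q^n′ : d ℕ.≤ q ℕ.^ n′
      d≤q^n′ = roots-≤-degree _≟_ (Tr-lead n′) 1≉0 Z.elt Z.elt-injective Z.elt-∈

      preimage : Fin d → Carrier
      preimage j with Fin.any? (λ i → T (from i) ≟ Z.elt j)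
      ... | yes (i , _) = from i
      -- A mere default: the indices supplied by `rootIndex` belong to values of `T`, for which the
      -- search succeeds.
      ... | no  _       = 0#

      T-preimage : ∀ j x → T x ≈ Z.elt j → T (preimage j) ≈ Z.elt j
      T-preimage j x Tx≈ with Fin.any? (λ i → T (from i) ≟ Z.elt j)
      ... | yes (i , eq) = eq
      ... | no  ¬∃       = contradiction (to x , trans (+-cong (φ-cong 1 (from-to x)) (-‿cong (from-to x))) Tx≈) ¬∃

      rootIndex : ∀ x → ∃ λ j → Z.elt j ≈ T x
      rootIndex x = Z.elt-onto (T x) (Tr[Tx]≈0 x)

      kernelIndex : ∀ x → ∃ λ i → F.elt i ≈ x - preimage (proj₁ (rootIndex x))
      kernelIndex x with j , eq ← rootIndex x =
        F.elt-onto (x - preimage j) (T-equal⇒Fq (trans (sym eq) (sym (T-preimage j x (sym eq)))))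

      indices-injective : ∀ {x y} → proj₁ (kernelIndex x) ≡ proj₁ (kernelIndex y) →
                          proj₁ (rootIndex x) ≡ proj₁ (rootIndex y) → x ≈ y
      indices-injective {x} {y} k≡ r≡ = +-cancelʳ (- preimage (proj₁ (rootIndex x))) x y (begin
        x - preimage (proj₁ (rootIndex x)) ≈⟨ proj₂ (kernelIndex x) ⟨
        F.elt (proj₁ (kernelIndex x))      ≡⟨ ≡.cong F.elt k≡ ⟩
        F.elt (proj₁ (kernelIndex y))      ≈⟨ proj₂ (kernelIndex y) ⟩
        y - preimage (proj₁ (rootIndex y)) ≡⟨ ≡.cong (λ k → y - preimage k) r≡ ⟨
        y - preimage (proj₁ (rootIndex x)) ∎)

      N≤c*d : q ℕ.^ n ℕ.≤ c ℕ.* d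
      N≤c*d = pair-injective⇒≤ (λ i → proj₁ (kernelIndex (from i))) (λ i → proj₁ (rootIndex (from i)))
        (λ k≡ r≡ → ≡.trans (≡.sym (to-from _)) (≡.trans (to-cong _ _ (indices-injective k≡ r≡)) (to-from _)))

      q≤c : q ℕ.≤ c
      q≤c = ℕ.*-cancelʳ-≤ q c (q ℕ.^ n′) ⦃ ℕ.m^n≢0 q n′ ⦄
        (ℕ.≤-trans N≤c*d (ℕ.*-monoʳ-≤ c d≤q^n′))

-- Dimension over F_q from the number of elements.

module Dimension (R : CommutativeRing 0ℓ 0ℓ) (isField : IsField R) (q : ℕ) (q-primePower : IsPrimePower q) (n′ : ℕ)
                 (card : HasCard R (q ℕ.^ suc n′))
                 (M : LeftSemimodule (CommutativeRing.semiring R) 0ℓ 0ℓ) where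
  open CommutativeRing R
  open FieldProperties R isField
  open FieldExtension R isField q q-primePower n′ card
  open LeftSemimodule M renaming (Carrierᴹ to V)
  open Span R q _≈ᴹ_ 0ᴹ _+ᴹ_ _*ₗ_
  open SetoidReasoning ≈ᴹ-setoid
  private module F = Enumeration Fq-enumeration

  interchange : ∀ u v w x → (u +ᴹ v) +ᴹ (w +ᴹ x) ≈ᴹ (u +ᴹ w) +ᴹ (v +ᴹ x)
  interchange = CommutativeSemigroupProperties.interchange
    (CommutativeMonoid.commutativeSemigroup +ᴹ-commutativeMonoid)

  lincomb-cong : ∀ {d} {c c′ : Fin d → Carrier} b → (∀ i → c i ≈ c′ i) → lincomb c b ≈ᴹ lincomb c′ b
  lincomb-cong {zero}  b eq = ≈ᴹ-refl
  lincomb-cong {suc d} b eq = +ᴹ-cong (*ₗ-cong (eq 0F) ≈ᴹ-refl) (lincomb-cong (b ∘ Fin.suc) (eq ∘ Fin.suc))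

  lincomb-+ : ∀ {d} (c c′ : Fin d → Carrier) b → lincomb (λ i → c i + c′ i) b ≈ᴹ lincomb c b +ᴹ lincomb c′ b
  lincomb-+ {zero}  c c′ b = ≈ᴹ-sym (+ᴹ-identityˡ 0ᴹ)
  lincomb-+ {suc d} c c′ b = ≈ᴹ-trans
    (+ᴹ-cong (*ₗ-distribʳ (b 0F) (c 0F) (c′ 0F)) (lincomb-+ (c ∘ Fin.suc) (c′ ∘ Fin.suc) (b ∘ Fin.suc)))
    (interchange _ _ _ _)

  lincomb-* : ∀ {d} a (c : Fin d → Carrier) b → lincomb (λ i → a * c i) b ≈ᴹ a *ₗ lincomb c b
  lincomb-* {zero}  a c b = ≈ᴹ-sym (*ₗ-zeroʳ a)
  lincomb-* {suc d} a c b = ≈ᴹ-trans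
    (+ᴹ-cong (*ₗ-assoc a (c 0F) (b 0F)) (lincomb-* a (c ∘ Fin.suc) (b ∘ Fin.suc)))
    (≈ᴹ-sym (*ₗ-distribˡ a _ _))

  lincomb-0 : ∀ {d} (b : Fin d → V) → lincomb (λ _ → 0#) b ≈ᴹ 0ᴹ
  lincomb-0 {zero}  b = ≈ᴹ-refl
  lincomb-0 {suc d} b = ≈ᴹ-trans (+ᴹ-cong (*ₗ-zeroˡ (b 0F)) (lincomb-0 (b ∘ Fin.suc))) (+ᴹ-identityˡ 0ᴹ)

  -- A semimodule has no negation of vectors; negated coefficients take its place.
  lincomb-inverse : ∀ {d} (c : Fin d → Carrier) b → lincomb c b +ᴹ lincomb (λ i → - c i) b ≈ᴹ 0ᴹ
  lincomb-inverse c b = ≈ᴹ-trans (≈ᴹ-sym (lincomb-+ c (λ i → - c i) b))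
    (≈ᴹ-trans (lincomb-cong b (λ i → -‿inverseʳ (c i))) (lincomb-0 b))

  lincomb-∈ : ∀ {P d} → IsSubspace P → {c : Fin d → Carrier} {b : Fin d → V} →
              (∀ i → Fq (c i)) → (∀ i → P (b i)) → P (lincomb c b)
  lincomb-∈ {d = zero}  (_ , P0 , _) c∈F b∈P = P0
  lincomb-∈ {d = suc d} sub@(_ , _ , P+ , P*) c∈F b∈P =
    P+ _ _ (P* _ _ (c∈F 0F) (b∈P 0F)) (lincomb-∈ sub (c∈F ∘ Fin.suc) (b∈P ∘ Fin.suc))

  Independent : ∀ {d} → (Fin d → V) → Set
  Independent b = ∀ c → (∀ i → Fq (c i)) → lincomb c b ≈ᴹ 0ᴹ → ∀ i → c i ≈ 0#

  coordinates-unique : ∀ {d} {b : Fin d → V} → Independent b → ∀ {c c′} → (∀ i → Fq (c i)) → (∀ i → Fq (c′ i)) →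
                       lincomb c b ≈ᴹ lincomb c′ b → ∀ i → c i ≈ c′ i
  coordinates-unique {b = b} ind {c} {c′} c∈F c′∈F eq i = trans
    (transpose (ind (λ i → c i - c′ i) (λ i → Fq-+ (c∈F i) (Fq-neg (c′∈F i))) (begin
      lincomb (λ i → c i - c′ i) b               ≈⟨ lincomb-+ c (λ i → - c′ i) b ⟩
      lincomb c b +ᴹ lincomb (λ i → - c′ i) b    ≈⟨ +ᴹ-cong eq ≈ᴹ-refl ⟩
      lincomb c′ b +ᴹ lincomb (λ i → - c′ i) b   ≈⟨ lincomb-inverse c′ b ⟩
      0ᴹ                                         ∎) i))
    (+-identityˡ (c′ i))

  _◂_ : ∀ {d} → V → (Fin d → V) → Fin (suc d) → V
  (v ◂ b) 0F          = v
  (v ◂ b) (Fin.suc i) = b i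

  ◂-independent : ∀ {d v} {b : Fin d → V} → Independent b →
    (∀ c → (∀ i → Fq (c i)) → ¬ (lincomb c b ≈ᴹ v)) → Independent (v ◂ b)
  ◂-independent {v = v} {b} ind v∉span c c∈F eq with c 0F ≟ 0#
  ... | yes c₀≈0 = λ { 0F → c₀≈0 ; (Fin.suc i) → ind (c ∘ Fin.suc) (c∈F ∘ Fin.suc) tail≈0 i }
    where
    tail≈0 : lincomb (c ∘ Fin.suc) b ≈ᴹ 0ᴹ
    tail≈0 = begin
      lincomb (c ∘ Fin.suc) b                ≈⟨ +ᴹ-identityˡ _ ⟨
      0ᴹ +ᴹ lincomb (c ∘ Fin.suc) b          ≈⟨ +ᴹ-cong (≈ᴹ-trans (*ₗ-cong c₀≈0 ≈ᴹ-refl) (*ₗ-zeroˡ v)) ≈ᴹ-refl ⟨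
      c 0F *ₗ v +ᴹ lincomb (c ∘ Fin.suc) b   ≈⟨ eq ⟩
      0ᴹ                                     ∎
  ... | no c₀≉0 with a , c₀a≈1 ← proj₂ isField (c 0F) c₀≉0 =
    contradiction (≈ᴹ-sym v≈) (v∉span c′ λ i → Fq-neg (Fq-* (Fq-inverse c₀≉0 c₀a≈1 (c∈F 0F)) (c∈F (Fin.suc i))))
    where
    ac c′ : Fin _ → Carrier
    ac i = a * c (Fin.suc i)
    c′ i = - ac i
    v+ac≈0 : v +ᴹ lincomb ac b ≈ᴹ 0ᴹ
    v+ac≈0 = begin
      v +ᴹ lincomb ac b                              ≈⟨ +ᴹ-cong (≈ᴹ-sym (*ₗ-identityˡ v)) (lincomb-* a (c ∘ Fin.suc) b) ⟩
      1# *ₗ v +ᴹ a *ₗ lincomb (c ∘ Fin.suc) b        ≈⟨ +ᴹ-cong (*ₗ-cong (sym (trans (*-comm a _) c₀a≈1)) ≈ᴹ-refl) ≈ᴹ-refl ⟩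
      (a * c 0F) *ₗ v +ᴹ a *ₗ lincomb (c ∘ Fin.suc) b ≈⟨ +ᴹ-cong (*ₗ-assoc a (c 0F) v) ≈ᴹ-refl ⟩
      a *ₗ (c 0F *ₗ v) +ᴹ a *ₗ lincomb (c ∘ Fin.suc) b ≈⟨ *ₗ-distribˡ a _ _ ⟨
      a *ₗ (c 0F *ₗ v +ᴹ lincomb (c ∘ Fin.suc) b)    ≈⟨ *ₗ-cong refl eq ⟩
      a *ₗ 0ᴹ                                        ≈⟨ *ₗ-zeroʳ a ⟩
      0ᴹ                                             ∎
    v≈ : v ≈ᴹ lincomb c′ b
    v≈ = begin
      v                                        ≈⟨ +ᴹ-identityʳ v ⟨
      v +ᴹ 0ᴹ                                  ≈⟨ +ᴹ-cong ≈ᴹ-refl (lincomb-inverse ac b) ⟨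
      v +ᴹ (lincomb ac b +ᴹ lincomb c′ b)      ≈⟨ +ᴹ-assoc _ _ _ ⟨
      (v +ᴹ lincomb ac b) +ᴹ lincomb c′ b      ≈⟨ +ᴹ-cong v+ac≈0 ≈ᴹ-refl ⟩
      0ᴹ +ᴹ lincomb c′ b                       ≈⟨ +ᴹ-identityˡ _ ⟩
      lincomb c′ b                             ∎

  -- Coefficient vectors over F_q of length d, numbered by reading the base-q digits of the index as
  -- positions in the list of F_q.
  scalars : ∀ d → Fin (q ℕ.^ d) → Fin d → Carrier
  scalars d k = F.elt ∘ finToFun {q} {d} k

  scalars-∈ : ∀ d (k : Fin (q ℕ.^ d)) i → Fq (scalars d k i)
  scalars-∈ d k i = F.elt-∈ (finToFun {q} {d} k i)

  scalars-injective : ∀ d {k l : Fin (q ℕ.^ d)} → (∀ i → scalars d k i ≈ scalars d l i) → k ≡ l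
  scalars-injective d {k} {l} eq = ≡.trans (≡.sym (Fin.funToFin-finToFin {d} k))
    (≡.trans (funToFin-cong {d} (λ i → F.elt-injective (eq i))) (Fin.funToFin-finToFin {d} l))

  digits : ∀ {d} (c : Fin d → Carrier) → (∀ i → Fq (c i)) → Fin (q ℕ.^ d)
  digits c c∈F = funToFin (λ i → proj₁ (F.elt-onto (c i) (c∈F i)))

  scalars-digits : ∀ {d} (c : Fin d → Carrier) (c∈F : ∀ i → Fq (c i)) i → scalars d (digits c c∈F) i ≈ c i
  scalars-digits {d} c c∈F i = trans (reflexive (≡.cong F.elt (Fin.finToFun-funToFin {d} _ i))) (proj₂ (F.elt-onto (c i) (c∈F i)))

  module _ {P : V → Set} (P-subspace : IsSubspace P) {m : ℕ} (E : Enumeration _≈ᴹ_ P (q ℕ.^ m)) where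
    private module E = Enumeration E

    combIndex : ∀ {d} (b : Fin d → V) → (∀ i → P (b i)) → (k : Fin (q ℕ.^ d)) →
                ∃ λ i → E.elt i ≈ᴹ lincomb (scalars d k) b
    combIndex {d} b b∈P k = E.elt-onto (lincomb (scalars d k) b) (lincomb-∈ P-subspace (scalars-∈ d k) b∈P)

    q^-cancel-≤ : ∀ {k l} → q ℕ.^ k ℕ.≤ q ℕ.^ l → k ℕ.≤ l
    q^-cancel-≤ q^k≤q^l = ℕ.≮⇒≥ λ l<k → ℕ.<⇒≱ (ℕ.^-monoʳ-< q 1<q l<k) q^k≤q^l

    -- The q^d coefficient vectors yield distinct elements of `P`, which has q^m.
    independent⇒≤ : ∀ {d} {b : Fin d → V} → (∀ i → P (b i)) → Independent b → d ℕ.≤ m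
    independent⇒≤ {d} {b} b∈P ind = q^-cancel-≤ (Fin.injective⇒≤ {f = λ k → proj₁ (combIndex b b∈P k)} λ {k} {l} eq →
      scalars-injective d (coordinates-unique ind (scalars-∈ d k) (scalars-∈ d l) (begin
        lincomb (scalars d k) b              ≈⟨ proj₂ (combIndex b b∈P k) ⟨
        E.elt (proj₁ (combIndex b b∈P k))  ≡⟨ ≡.cong E.elt eq ⟩
        E.elt (proj₁ (combIndex b b∈P l))  ≈⟨ proj₂ (combIndex b b∈P l) ⟩
        lincomb (scalars d l) b              ∎)))

    -- Each of the q^m elements can be recovered from the number of one of its coefficient vectors,
    -- and there are q^d of those.
    spanning⇒≥ : ∀ {d} {b : Fin d → V} →
      (∀ v → P v → Σ (Fin d → Carrier) λ c → (∀ i → Fq (c i)) × lincomb c b ≈ᴹ v) → m ℕ.≤ d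
    spanning⇒≥ {d} {b} span = q^-cancel-≤ (Fin.injective⇒≤ {f = code} λ {i} {j} eq → E.elt-injective (begin
        E.elt i                    ≈⟨ decode i ⟨
        lincomb (scalars d (code i)) b ≡⟨ ≡.cong (λ k → lincomb (scalars d k) b) eq ⟩
        lincomb (scalars d (code j)) b ≈⟨ decode j ⟩
        E.elt j                    ∎))
      where
      coordinates : ∀ i → Σ (Fin d → Carrier) λ c → (∀ j → Fq (c j)) × lincomb c b ≈ᴹ E.elt i
      coordinates i = span (E.elt i) (E.elt-∈ i)
      code : Fin (q ℕ.^ m) → Fin (q ℕ.^ d)
      code i = digits (proj₁ (coordinates i)) (proj₁ (proj₂ (coordinates i)))
      decode : ∀ i → lincomb (scalars d (code i)) b ≈ᴹ E.elt i
      decode i = ≈ᴹ-trans (lincomb-cong b (scalars-digits _ _)) (proj₂ (proj₂ (coordinates i)))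

    dim-unique : ∀ {d} → HasDim P d → d ≡ m
    dim-unique (b , b∈P , ind , span) = ℕ.≤-antisym (independent⇒≤ b∈P ind) (spanning⇒≥ span)

    -- An independent family, at first empty, is extended by elements outside its span. The fuel k
    -- satisfies m < k + d, so running out would mean m < d, against `independent⇒≤`. The final
    -- length is m by `dim-unique`.
    hasDim : HasDim P m
    hasDim = grow (suc m) {0} {λ ()} (λ ()) (λ _ _ _ ()) (s≤s (ℕ.m≤m+n m 0))
      where
      grow : ∀ k {d} {b : Fin d → V} → (∀ i → P (b i)) → Independent b → m ℕ.< k ℕ.+ d → HasDim P m
      grow zero    b∈P ind m<d = contradiction (independent⇒≤ b∈P ind) (ℕ.<⇒≱ m<d)
      -- Spanning is decidable by finite search: does every index of `E` arise from one of the q^d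
      -- combinations?
      grow (suc k) {d} {b} b∈P ind m<k+d with Fin.all? (λ i → Fin.any? (λ l → proj₁ (combIndex b b∈P l) Fin.≟ i))
      ... | yes all = ≡.subst (HasDim P) (dim-unique dim) dim
        where
        dim : HasDim P d
        dim = b , b∈P , ind , λ v v∈P →
          let i , elt≈v = E.elt-onto v v∈P
              l , index≡i = all i
          in scalars d l , scalars-∈ d l , (begin
            lincomb (scalars d l) b              ≈⟨ proj₂ (combIndex b b∈P l) ⟨
            E.elt (proj₁ (combIndex b b∈P l))  ≡⟨ ≡.cong E.elt index≡i ⟩
            E.elt i                            ≈⟨ elt≈v ⟩
            v                                  ∎)
      ... | no ¬all with i , ¬any ← Fin.¬∀⟶∃¬ _ _ (λ i → Fin.any? (λ l → proj₁ (combIndex b b∈P l) Fin.≟ i)) ¬all =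
        grow k {b = E.elt i ◂ b} (λ { 0F → E.elt-∈ i ; (Fin.suc j) → b∈P j })
          (◂-independent ind λ c c∈F eq → ¬any (digits c c∈F , E.elt-injective (begin
            E.elt (proj₁ (combIndex b b∈P (digits c c∈F))) ≈⟨ proj₂ (combIndex b b∈P (digits c c∈F)) ⟩
            lincomb (scalars d (digits c c∈F)) b             ≈⟨ lincomb-cong b (scalars-digits c c∈F) ⟩
            lincomb c b                                    ≈⟨ eq ⟩
            E.elt i                                        ∎)))
          (≡.subst (m ℕ.<_) (≡.sym (ℕ.+-suc k d)) m<k+d)

-- Codewords: linearity in the coefficients and in the argument.

module Code (R : CommutativeRing 0ℓ 0ℓ) (isField : IsField R) (q : ℕ) (q-primePower : IsPrimePower q) (n′ : ℕ)
            (card : HasCard R (q ℕ.^ suc n′)) (2≤n′ : 2 ℕ.≤ n′) (s : ℕ) (gcd≡1 : gcd s (suc n′) ≡ 1) where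
  open CommutativeRing R
  open FieldProperties R isField
  open FieldExtension R isField q q-primePower n′ card
  open RingProperties ring using (-‿distribˡ-*; -‿distribʳ-*; +-inverseˡ-unique; +-cancelʳ)
  open Solver commutativeSemiring using (solve; _:+_; _:*_; _:=_)
  open SetoidReasoning setoid

  -- Operations and equality on functions are spelled as in `SpFun`, so that the results on
  -- dimension apply to `IsRank` without translation.
  scalarModule functionModule : LeftSemimodule semiring 0ℓ 0ℓ
  scalarModule = TensorUnit.leftSemimodule
  functionModule = record
    { Carrierᴹ = Carrier → Carrier
    ; _≈ᴹ_ = λ f g → ∀ x → f x ≈ g x
    ; _+ᴹ_ = λ f g x → f x + g x
    ; _*ₗ_ = λ a f x → a * f x
    ; 0ᴹ   = λ _ → 0#
    ; isLeftSemimodule = record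
      { +ᴹ-isCommutativeMonoid = Pointwise.isCommutativeMonoid Carrier +-isCommutativeMonoid
      ; isPreleftSemimodule = record
        { *ₗ-cong      = λ a≈b f≈g x → *-cong a≈b (f≈g x)
        ; *ₗ-zeroˡ     = λ f x → zeroˡ (f x)
        ; *ₗ-distribʳ  = λ f a b x → distribʳ (f x) a b
        ; *ₗ-identityˡ = λ f x → *-identityˡ (f x)
        ; *ₗ-assoc     = λ a b f x → *-assoc a b (f x)
        ; *ₗ-zeroʳ     = λ a x → zeroʳ a
        ; *ₗ-distribˡ  = λ a f g x → distribˡ a (f x) (g x)
        }
      }
    }

  module K = Dimension R isField q q-primePower n′ card scalarModule
  module Fun = Dimension R isField q q-primePower n′ card functionModule
  open SpK R q using (lincomb)

  σ τ : Carrier → Carrier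
  σ = φ s
  τ = φ (s ℕ.* n′)

  φ[s*n]≈id : ∀ x → φ (s ℕ.* n) x ≈ x
  φ[s*n]≈id x = φ-multiple n (φ-n x) s

  τσ≈id : ∀ x → τ (σ x) ≈ x
  τσ≈id x = trans (φ-∘ s (s ℕ.* n′) x)
    (trans (reflexive (≡.cong (λ k → φ k x) (≡.sym (ℕ.*-suc s n′)))) (φ[s*n]≈id x))

  στ≈id : ∀ x → σ (τ x) ≈ x
  στ≈id x = trans (φ-∘ (s ℕ.* n′) s x)
    (trans (reflexive (≡.cong (λ k → φ k x) (≡.trans (ℕ.+-comm (s ℕ.* n′) s) (≡.sym (ℕ.*-suc s n′))))) (φ[s*n]≈id x))

  σ-fixed⇒Fq : ∀ {a} → σ a ≈ a → Fq a
  σ-fixed⇒Fq = φ-fixed⇒Fq {s} gcd≡1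

  τ-fixed⇒Fq : ∀ {a} → τ a ≈ a → Fq a
  τ-fixed⇒Fq {a} τa≈a = σ-fixed⇒Fq (trans (sym (φ-cong s τa≈a)) (στ≈id a))

  code : Carrier → Carrier → Carrier → Carrier
  code b₀ b₁ x = (b₀ * x + b₁ * σ x) + τ (b₁ * x)

  code-cong : ∀ {b₀ b₁ c₀ c₁ x y} → b₀ ≈ c₀ → b₁ ≈ c₁ → x ≈ y → code b₀ b₁ x ≈ code c₀ c₁ y
  code-cong b₀≈ b₁≈ x≈ =
    +-cong (+-cong (*-cong b₀≈ x≈) (*-cong b₁≈ (φ-cong s x≈))) (φ-cong (s ℕ.* n′) (*-cong b₁≈ x≈))

  code-+ : ∀ b₀ b₁ c₀ c₁ x → code (b₀ + c₀) (b₁ + c₁) x ≈ code b₀ b₁ x + code c₀ c₁ x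
  code-+ b₀ b₁ c₀ c₁ x = begin
    code (b₀ + c₀) (b₁ + c₁) x
      ≈⟨ +-congˡ (trans (φ-cong (s ℕ.* n′) (distribʳ x b₁ c₁)) (φ-+ (s ℕ.* n′) _ _)) ⟩
    ((b₀ + c₀) * x + (b₁ + c₁) * σ x) + (τ (b₁ * x) + τ (c₁ * x))
      ≈⟨ solve 8 (λ b₀ b₁ c₀ c₁ x y t t′ → ((b₀ :+ c₀) :* x :+ (b₁ :+ c₁) :* y) :+ (t :+ t′)
                    := ((b₀ :* x :+ b₁ :* y) :+ t) :+ ((c₀ :* x :+ c₁ :* y) :+ t′))
           refl b₀ b₁ c₀ c₁ x (σ x) (τ (b₁ * x)) (τ (c₁ * x)) ⟩
    code b₀ b₁ x + code c₀ c₁ x ∎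

  code-* : ∀ {a} → Fq a → ∀ b₀ b₁ x → code (a * b₀) (a * b₁) x ≈ a * code b₀ b₁ x
  code-* {a} a∈F b₀ b₁ x = begin
    code (a * b₀) (a * b₁) x
      ≈⟨ +-congˡ (trans (φ-cong (s ℕ.* n′) (*-assoc a b₁ x)) (trans (φ-* (s ℕ.* n′) _ _) (*-congʳ (Fq⇒φ-fixed a∈F (s ℕ.* n′))))) ⟩
    (a * b₀ * x + a * b₁ * σ x) + a * τ (b₁ * x)
      ≈⟨ solve 6 (λ a b₀ b₁ x y t → (a :* b₀ :* x :+ a :* b₁ :* y) :+ a :* t := a :* ((b₀ :* x :+ b₁ :* y) :+ t))
           refl a b₀ b₁ x (σ x) (τ (b₁ * x)) ⟩
    a * code b₀ b₁ x ∎

  code-0 : ∀ x → code 0# 0# x ≈ 0#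
  code-0 x = begin
    (0# * x + 0# * σ x) + τ (0# * x) ≈⟨ +-cong (+-cong (zeroˡ x) (zeroˡ _)) (trans (φ-cong (s ℕ.* n′) (zeroˡ x)) (φ-0# (s ℕ.* n′))) ⟩
    (0# + 0#) + 0#                   ≈⟨ trans (+-identityʳ _) (+-identityʳ _) ⟩
    0#                               ∎

  code-arg-+ : ∀ b₀ b₁ x y → code b₀ b₁ (x + y) ≈ code b₀ b₁ x + code b₀ b₁ y
  code-arg-+ b₀ b₁ x y = begin
    code b₀ b₁ (x + y)
      ≈⟨ +-cong (+-congˡ (*-congˡ (φ-+ s x y))) (trans (φ-cong (s ℕ.* n′) (distribˡ b₁ x y)) (φ-+ (s ℕ.* n′) _ _)) ⟩
    (b₀ * (x + y) + b₁ * (σ x + σ y)) + (τ (b₁ * x) + τ (b₁ * y))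
      ≈⟨ solve 8 (λ b₀ b₁ x y x′ y′ t t′ → (b₀ :* (x :+ y) :+ b₁ :* (x′ :+ y′)) :+ (t :+ t′)
                    := ((b₀ :* x :+ b₁ :* x′) :+ t) :+ ((b₀ :* y :+ b₁ :* y′) :+ t′))
           refl b₀ b₁ x y (σ x) (σ y) (τ (b₁ * x)) (τ (b₁ * y)) ⟩
    code b₀ b₁ x + code b₀ b₁ y ∎

  code-arg-* : ∀ b₀ b₁ {a} → Fq a → ∀ x → code b₀ b₁ (a * x) ≈ a * code b₀ b₁ x
  code-arg-* b₀ b₁ {a} a∈F x = begin
    code b₀ b₁ (a * x)
      ≈⟨ +-cong (+-congˡ (*-congˡ (trans (φ-* s a x) (*-congʳ (Fq⇒φ-fixed a∈F s)))))
                (trans (φ-cong (s ℕ.* n′) (solve 3 (λ a b x → b :* (a :* x) := a :* (b :* x)) refl a b₁ x))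
                       (trans (φ-* (s ℕ.* n′) a _) (*-congʳ (Fq⇒φ-fixed a∈F (s ℕ.* n′))))) ⟩
    (b₀ * (a * x) + b₁ * (a * σ x)) + a * τ (b₁ * x)
      ≈⟨ solve 6 (λ a b₀ b₁ x y t → (b₀ :* (a :* x) :+ b₁ :* (a :* y)) :+ a :* t := a :* ((b₀ :* x :+ b₁ :* y) :+ t))
           refl a b₀ b₁ x (σ x) (τ (b₁ * x)) ⟩
    a * code b₀ b₁ x ∎

  -- Reduces vanishing on a subspace to vanishing on a basis.
  code-lincomb : ∀ b₀ b₁ {d} (c : Fin d → Carrier) (b : Fin d → Carrier) → (∀ i → Fq (c i)) →
                 (∀ i → code b₀ b₁ (b i) ≈ 0#) → code b₀ b₁ (lincomb c b) ≈ 0#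
  code-lincomb b₀ b₁ {zero}  c b c∈F zeros = begin
    code b₀ b₁ 0#        ≈⟨ code-cong refl refl (zeroˡ 0#) ⟨
    code b₀ b₁ (0# * 0#) ≈⟨ code-arg-* b₀ b₁ Fq-0 0# ⟩
    0# * code b₀ b₁ 0#   ≈⟨ zeroˡ _ ⟩
    0#                   ∎
  code-lincomb b₀ b₁ {suc d} c b c∈F zeros = begin
    code b₀ b₁ (c 0F * b 0F + lincomb (c ∘ Fin.suc) (b ∘ Fin.suc)) ≈⟨ code-arg-+ b₀ b₁ _ _ ⟩
    code b₀ b₁ (c 0F * b 0F) + code b₀ b₁ (lincomb (c ∘ Fin.suc) (b ∘ Fin.suc))
      ≈⟨ +-cong (trans (code-arg-* b₀ b₁ (c∈F 0F) (b 0F)) (trans (*-congˡ (zeros 0F)) (zeroʳ _)))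
                (code-lincomb b₀ b₁ (c ∘ Fin.suc) (b ∘ Fin.suc) (c∈F ∘ Fin.suc) (zeros ∘ Fin.suc)) ⟩
    0# + 0# ≈⟨ +-identityʳ 0# ⟩
    0#      ∎

  -- Common zeros of a codeword and the determinant of two elements.

  -- Up to sign, the 2 × 2 Moore determinant for σ.
  det : Carrier → Carrier → Carrier
  det v w = w * σ v - v * σ w

  cross-sub : ∀ {a b c d} → a + d ≈ c + b → a - b ≈ c - d
  cross-sub {a} {b} {c} {d} eq = subtract (begin
    a               ≈⟨ subtract refl ⟨
    a + d - d       ≈⟨ +-congʳ eq ⟩
    c + b - d       ≈⟨ solve 3 (λ c b d → c :+ b :+ d := c :+ d :+ b) refl c b (- d) ⟩
    c - d + b       ∎)

  cross-add : ∀ {a b c d} → a - b ≈ c - d → a + d ≈ c + b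
  cross-add {a} {b} {c} {d} eq = begin
    a + d             ≈⟨ +-congʳ (transpose eq) ⟩
    (c - d + b) + d   ≈⟨ solve 4 (λ c d′ b d → (c :+ d′ :+ b) :+ d := c :+ b :+ d′ :+ d) refl c (- d) b d ⟩
    c + b - d + d     ≈⟨ transpose refl ⟨
    c + b             ∎

  *-distribˡ-sub : ∀ a b c → a * (b - c) ≈ a * b - a * c
  *-distribˡ-sub a b c = trans (distribˡ a b (- c)) (+-congˡ (sym (-‿distribʳ-* a c)))

  b*det : ∀ b v w → b * det v w ≈ b * (w * σ v) - b * (v * σ w)
  b*det b v w = *-distribˡ-sub b _ _

  -- Because τ undoes σ, the result is made of just the τ-terms that remain when b₀ is eliminated.
  τ[b*det] : ∀ b v w → τ (b * det v w) ≈ τ b * (τ w * v) - τ b * (τ v * w)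
  τ[b*det] b v w = begin
    τ (b * det v w)                            ≈⟨ φ-* (s ℕ.* n′) b _ ⟩
    τ b * τ (det v w)                          ≈⟨ *-congˡ (trans (φ-+ (s ℕ.* n′) _ _) (+-congˡ (φ-neg (s ℕ.* n′) _))) ⟩
    τ b * (τ (w * σ v) - τ (v * σ w))          ≈⟨ *-congˡ (+-cong (half w v) (-‿cong (half v w))) ⟩
    τ b * (τ w * v - τ v * w)                  ≈⟨ *-distribˡ-sub (τ b) _ _ ⟩
    τ b * (τ w * v) - τ b * (τ v * w)          ∎
    where
    half : ∀ v w → τ (v * σ w) ≈ τ v * w
    half v w = trans (φ-* (s ℕ.* n′) v (σ w)) (*-congˡ (τσ≈id w))

  -- The equation b · det v w = τ (b · det v w), expanded and with the negative terms moved across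
  -- to suit the semiring solver.
  Balanced : Carrier → Carrier → Carrier → Set
  Balanced b v w = b * (w * σ v) + τ b * (τ v * w) ≈ τ b * (τ w * v) + b * (v * σ w)

  balanced⇒Fq : ∀ {b v w} → Balanced b v w → Fq (b * det v w)
  balanced⇒Fq {b} {v} {w} eq = τ-fixed⇒Fq (trans (τ[b*det] b v w) (trans (sym (cross-sub eq)) (sym (b*det b v w))))

  Fq⇒balanced : ∀ {b v w} → Fq (b * det v w) → Balanced b v w
  Fq⇒balanced {b} {v} {w} ∈F = cross-add
    (trans (sym (b*det b v w)) (trans (sym (Fq⇒φ-fixed ∈F (s ℕ.* n′))) (τ[b*det] b v w)))

  -- Eliminating b₀ between the values at v and w.
  eliminate : ∀ b₀ b₁ v w → w * code b₀ b₁ v + (τ b₁ * (τ w * v) + b₁ * (v * σ w))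
                          ≈ v * code b₀ b₁ w + (b₁ * (w * σ v) + τ b₁ * (τ v * w))
  eliminate b₀ b₁ v w = begin
    w * code b₀ b₁ v + (τ b₁ * (τ w * v) + b₁ * (v * σ w)) ≈⟨ +-congʳ (*-congˡ (+-congˡ (φ-* (s ℕ.* n′) b₁ v))) ⟩
    w * ((b₀ * v + b₁ * σ v) + τ b₁ * τ v) + (τ b₁ * (τ w * v) + b₁ * (v * σ w))
      ≈⟨ solve 9 (λ b₀ b₁ t v w v′ w′ v″ w″ →
           w :* ((b₀ :* v :+ b₁ :* v′) :+ t :* v″) :+ (t :* (w″ :* v) :+ b₁ :* (v :* w′))
        := v :* ((b₀ :* w :+ b₁ :* w′) :+ t :* w″) :+ (b₁ :* (w :* v′) :+ t :* (v″ :* w)))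
           refl b₀ b₁ (τ b₁) v w (σ v) (σ w) (τ v) (τ w) ⟩
    v * ((b₀ * w + b₁ * σ w) + τ b₁ * τ w) + (b₁ * (w * σ v) + τ b₁ * (τ v * w)) ≈⟨ +-congʳ (*-congˡ (+-congˡ (φ-* (s ℕ.* n′) b₁ w))) ⟨
    v * code b₀ b₁ w + (b₁ * (w * σ v) + τ b₁ * (τ v * w)) ∎

  zeros⇒Fq : ∀ {b₀ b₁ v w} → code b₀ b₁ v ≈ 0# → code b₀ b₁ w ≈ 0# → Fq (b₁ * det v w)
  zeros⇒Fq {b₀} {b₁} {v} {w} fv≈0 fw≈0 = balanced⇒Fq (begin
    _                          ≈⟨ +-identityˡ _ ⟨
    0# + _                     ≈⟨ +-congʳ (trans (*-congˡ fw≈0) (zeroʳ v)) ⟨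
    v * code b₀ b₁ w + _       ≈⟨ eliminate b₀ b₁ v w ⟨
    w * code b₀ b₁ v + _       ≈⟨ +-congʳ (trans (*-congˡ fv≈0) (zeroʳ w)) ⟩
    0# + _                     ≈⟨ +-identityˡ _ ⟩
    _                          ∎)

  -- The elimination read backwards: once the remainders balance, v f(w) = w f(v) = 0. This makes
  -- the condition on b₁ sufficient as well as necessary.
  zero-transfer : ∀ {b₀ b₁ v w} → ¬ (v ≈ 0#) → Fq (b₁ * det v w) → code b₀ b₁ v ≈ 0# → code b₀ b₁ w ≈ 0#
  zero-transfer {b₀} {b₁} {v} {w} v≉0 ∈F fv≈0 = *-cancelʳ v≉0 (begin
    code b₀ b₁ w * v   ≈⟨ *-comm _ v ⟩
    v * code b₀ b₁ w   ≈⟨ +-cancelʳ _ _ _ (begin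
      v * code b₀ b₁ w + (b₁ * (w * σ v) + τ b₁ * (τ v * w)) ≈⟨ eliminate b₀ b₁ v w ⟨
      w * code b₀ b₁ v + (τ b₁ * (τ w * v) + b₁ * (v * σ w)) ≈⟨ +-cong (trans (*-congˡ fv≈0) (zeroʳ w)) (sym (Fq⇒balanced ∈F)) ⟩
      0# + (b₁ * (w * σ v) + τ b₁ * (τ v * w))               ∎) ⟩
    0#                 ≈⟨ zeroˡ v ⟨
    0# * v             ∎)

  -- A vanishing determinant says w / v = σ w / σ v, so the quotient t = w / v is fixed by σ.
  det≈0⇒multiple : ∀ {v w} → ¬ (v ≈ 0#) → det v w ≈ 0# → Σ Carrier λ t → Fq t × w ≈ t * v
  det≈0⇒multiple {v} {w} v≉0 det≈0 with v⁻¹ , vv⁻¹≈1 ← proj₂ isField v v≉0 =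
    t , σ-fixed⇒Fq σt≈t , w≈tv
    where
    t = w * v⁻¹
    w≈tv : w ≈ t * v
    w≈tv = begin
      w             ≈⟨ *-identityʳ w ⟨
      w * 1#        ≈⟨ *-congˡ vv⁻¹≈1 ⟨
      w * (v * v⁻¹) ≈⟨ solve 3 (λ w v u → w :* (v :* u) := w :* u :* v) refl w v v⁻¹ ⟩
      t * v         ∎
    σt≈t : σ t ≈ t
    σt≈t = *-cancelʳ (*-≉0 v≉0 (pow-≉0 (q ℕ.^ s) v≉0)) (begin
      σ t * (v * σ v) ≈⟨ solve 3 (λ a b c → a :* (b :* c) := b :* (a :* c)) refl (σ t) v (σ v) ⟩
      v * (σ t * σ v) ≈⟨ *-congˡ (trans (φ-cong s w≈tv) (φ-* s t v)) ⟨
      v * σ w         ≈⟨ trans (transpose det≈0) (+-identityˡ _) ⟨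
      w * σ v         ≈⟨ *-congʳ w≈tv ⟩
      t * v * σ v     ≈⟨ *-assoc t v (σ v) ⟩
      t * (v * σ v)   ∎)

  det-linear : ∀ {a} → Fq a → ∀ v w x → det v (w + a * x) ≈ det v w + a * det v x
  det-linear {a} a∈F v w x = begin
    (w + a * x) * σ v - v * σ (w + a * x)
      ≈⟨ cross-sub (begin
        (w + a * x) * σ v + (v * σ w + a * (v * σ x))
          ≈⟨ solve 6 (λ a v w x y z → (w :+ a :* x) :* z :+ y := (w :* z :+ a :* (x :* z)) :+ y) refl a v w x (v * σ w + a * (v * σ x)) (σ v) ⟩
        (w * σ v + a * (x * σ v)) + (v * σ w + a * (v * σ x))
          ≈⟨ +-congˡ (begin
            v * σ w + a * (v * σ x) ≈⟨ solve 4 (λ a v w x → v :* w :+ a :* (v :* x) := v :* (w :+ a :* x)) refl a v (σ w) (σ x) ⟩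
            v * (σ w + a * σ x)     ≈⟨ *-congˡ (trans (φ-+ s w (a * x)) (+-congˡ (trans (φ-* s a x) (*-congʳ (Fq⇒φ-fixed a∈F s))))) ⟨
            v * σ (w + a * x)       ∎) ⟩
        (w * σ v + a * (x * σ v)) + v * σ (w + a * x) ∎) ⟩
    (w * σ v + a * (x * σ v)) - (v * σ w + a * (v * σ x))
      ≈⟨ subtract (begin
        w * σ v + a * (x * σ v)
          ≈⟨ +-cong (transpose refl) (*-congˡ (transpose refl)) ⟩
        (det v w + v * σ w) + a * (det v x + v * σ x)
          ≈⟨ solve 5 (λ d d′ a y z → (d :+ y) :+ a :* (d′ :+ z) := (d :+ a :* d′) :+ (y :+ a :* z))
               refl (det v w) (det v x) a (v * σ w) (v * σ x) ⟩
        (det v w + a * det v x) + (v * σ w + a * (v * σ x)) ∎) ⟩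
    det v w + a * det v x ∎

  -- Independence is tested on the coefficients (1, 0, ...), in the next two lemmas on (-t, 1, 0,
  -- ...) and (-t, a, 1, 0, ...). The entry 1 gives the contradiction, and the padding by zeros
  -- admits families of any greater length.
  head≉0 : ∀ {d} (b : Fin (suc d) → Carrier) → K.Independent b → ¬ (b 0F ≈ 0#)
  head≉0 b ind b₀≈0 = 1≉0 (ind (1# ∷ λ _ → 0#) (λ { 0F → Fq-1 ; (Fin.suc i) → Fq-0 }) (begin
    1# * b 0F + lincomb (λ _ → 0#) (b ∘ Fin.suc) ≈⟨ +-cong (trans (*-identityˡ _) b₀≈0) (K.lincomb-0 (b ∘ Fin.suc)) ⟩
    0# + 0#                                      ≈⟨ +-identityʳ 0# ⟩
    0#                                           ∎) 0F)

  second≉multiple : ∀ {d} (b : Fin (2 ℕ.+ d) → Carrier) → K.Independent b → ∀ {t} → Fq t → ¬ (b 1F ≈ t * b 0F)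
  second≉multiple b ind {t} t∈F eq = 1≉0 (ind (- t ∷ 1# ∷ λ _ → 0#)
    (λ { 0F → Fq-neg t∈F ; 1F → Fq-1 ; (Fin.suc (Fin.suc i)) → Fq-0 }) (begin
    - t * b 0F + (1# * b 1F + lincomb (λ _ → 0#) (b ∘ Fin.suc ∘ Fin.suc))
      ≈⟨ +-congˡ (+-cong (trans (*-identityˡ _) eq) (K.lincomb-0 (b ∘ Fin.suc ∘ Fin.suc))) ⟩
    - t * b 0F + (t * b 0F + 0#)   ≈⟨ +-congˡ (+-identityʳ _) ⟩
    - t * b 0F + t * b 0F          ≈⟨ distribʳ (b 0F) (- t) t ⟨
    (- t + t) * b 0F               ≈⟨ trans (*-congʳ (-‿inverseˡ t)) (zeroˡ _) ⟩
    0#                             ∎) 1F)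

  third≉combination : ∀ {d} (b : Fin (3 ℕ.+ d) → Carrier) → K.Independent b →
                      ∀ {a t} → Fq a → Fq t → ¬ (b 2F + a * b 1F ≈ t * b 0F)
  third≉combination b ind {a} {t} a∈F t∈F eq = 1≉0 (ind (- t ∷ a ∷ 1# ∷ λ _ → 0#)
    (λ { 0F → Fq-neg t∈F ; 1F → a∈F ; 2F → Fq-1 ; (Fin.suc (Fin.suc (Fin.suc i))) → Fq-0 }) (begin
    - t * b 0F + (a * b 1F + (1# * b 2F + lincomb (λ _ → 0#) (b ∘ Fin.suc ∘ Fin.suc ∘ Fin.suc)))
      ≈⟨ +-congˡ (+-congˡ (+-cong (*-identityˡ _) (K.lincomb-0 (b ∘ Fin.suc ∘ Fin.suc ∘ Fin.suc)))) ⟩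
    - t * b 0F + (a * b 1F + (b 2F + 0#)) ≈⟨ +-congˡ (trans (+-congˡ (+-identityʳ _)) (trans (+-comm _ _) eq)) ⟩
    - t * b 0F + t * b 0F          ≈⟨ distribʳ (b 0F) (- t) t ⟨
    (- t + t) * b 0F               ≈⟨ trans (*-congʳ (-‿inverseˡ t)) (zeroˡ _) ⟩
    0#                             ∎) 2F)

  det≉0 : ∀ {d} (b : Fin (2 ℕ.+ d) → Carrier) → K.Independent b → ¬ (det (b 0F) (b 1F) ≈ 0#)
  det≉0 b ind det≈0 = let t , t∈F , eq = det≈0⇒multiple {b 0F} {b 1F} (head≉0 b ind) det≈0 in second≉multiple b ind {t} t∈F eq

  -- If b₁ ≉ 0, both b₁ det(w₀,w₁) and b₁ det(w₀,w₂) lie in Fq, hence so does a = - det(w₀,w₂)/det(w₀,w₁);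
  -- then det(w₀, w₂ + a w₁) vanishes, making w₀, w₁, w₂ dependent.
  three-zeros⇒b₁≈0 : ∀ {d} (b : Fin (3 ℕ.+ d) → Carrier) → K.Independent b → ∀ {b₀ b₁} →
                     (∀ i → code b₀ b₁ (b i) ≈ 0#) → b₁ ≈ 0#
  three-zeros⇒b₁≈0 b ind {b₀} {b₁} zeros = decidable-stable (b₁ ≟ 0#) λ b₁≉0 →
    let open Dependence b₁≉0 in third≉combination b ind a∈F (proj₁ (proj₂ multiple)) (proj₂ (proj₂ multiple))
    where
    module Dependence (b₁≉0 : ¬ (b₁ ≈ 0#)) where
      d₁ = det (b 0F) (b 1F)
      d₂ = det (b 0F) (b 2F)
      x = b₁ * d₁
      y = b₁ * d₂
      x≉0 = *-≉0 b₁≉0 (det≉0 b ind)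
      x⁻¹ = proj₁ (proj₂ isField x x≉0)
      xx⁻¹≈1 = proj₂ (proj₂ isField x x≉0)
      a = - (y * x⁻¹)
      x∈F = zeros⇒Fq {b₀} {b₁} {b 0F} {b 1F} (zeros 0F) (zeros 1F)
      y∈F = zeros⇒Fq {b₀} {b₁} {b 0F} {b 2F} (zeros 0F) (zeros 2F)
      a∈F : Fq a
      a∈F = Fq-neg (Fq-* y∈F (Fq-inverse x≉0 xx⁻¹≈1 x∈F))
      d₂≈ : d₂ ≈ (y * x⁻¹) * d₁
      d₂≈ = *-cancelʳ b₁≉0 (begin
        d₂ * b₁               ≈⟨ *-comm d₂ b₁ ⟩
        y                     ≈⟨ *-identityʳ y ⟨
        y * 1#                ≈⟨ *-congˡ xx⁻¹≈1 ⟨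
        y * (b₁ * d₁ * x⁻¹)   ≈⟨ solve 4 (λ y b d u → y :* (b :* d :* u) := y :* u :* d :* b) refl y b₁ d₁ x⁻¹ ⟩
        y * x⁻¹ * d₁ * b₁     ∎)
      multiple = det≈0⇒multiple {b 0F} {b 2F + a * b 1F} (head≉0 b ind) (begin
        det (b 0F) (b 2F + a * b 1F)   ≈⟨ det-linear a∈F (b 0F) (b 2F) (b 1F) ⟩
        d₂ + a * d₁                    ≈⟨ +-congʳ d₂≈ ⟩
        y * x⁻¹ * d₁ + a * d₁          ≈⟨ distribʳ d₁ _ _ ⟨
        (y * x⁻¹ - y * x⁻¹) * d₁       ≈⟨ trans (*-congʳ (-‿inverseʳ _)) (zeroˡ d₁) ⟩
        0#                             ∎)

  -- The part of f(w) that depends on b₁ alone; f(w) = 0 then fixes b₀ · w, and thus b₀ when w is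
  -- nonzero.
  tailPart : Carrier → Carrier → Carrier
  tailPart w b₁ = b₁ * σ w + τ (b₁ * w)

  tailPart-0 : ∀ w → tailPart w 0# ≈ 0#
  tailPart-0 w = trans (+-cong (zeroˡ _) (trans (φ-cong (s ℕ.* n′) (zeroˡ w)) (φ-0# (s ℕ.* n′)))) (+-identityʳ 0#)

  tailPart-cong : ∀ w {b c} → b ≈ c → tailPart w b ≈ tailPart w c
  tailPart-cong w b≈c = +-cong (*-congʳ b≈c) (φ-cong (s ℕ.* n′) (*-congʳ b≈c))

  solve-b₀ : ∀ {w} → ¬ (w ≈ 0#) → Carrier → Carrier
  solve-b₀ {w} w≉0 b₁ = - (tailPart w b₁ * proj₁ (proj₂ isField w w≉0))

  solve-b₀-* : ∀ {w} (w≉0 : ¬ (w ≈ 0#)) b₁ → solve-b₀ w≉0 b₁ * w ≈ - tailPart w b₁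
  solve-b₀-* {w} w≉0 b₁ with w⁻¹ , ww⁻¹≈1 ← proj₂ isField w w≉0 = begin
    - (tailPart w b₁ * w⁻¹) * w ≈⟨ -‿distribˡ-* _ w ⟨
    - (tailPart w b₁ * w⁻¹ * w) ≈⟨ -‿cong (trans (*-assoc _ w⁻¹ w) (trans (*-congˡ (trans (*-comm w⁻¹ w) ww⁻¹≈1)) (*-identityʳ _))) ⟩
    - tailPart w b₁             ∎

  solve-b₀-zero : ∀ {w} (w≉0 : ¬ (w ≈ 0#)) b₁ → code (solve-b₀ w≉0 b₁) b₁ w ≈ 0#
  solve-b₀-zero {w} w≉0 b₁ = trans (+-assoc _ _ _) (trans (+-congʳ (solve-b₀-* w≉0 b₁)) (-‿inverseˡ _))

  solve-b₀-unique : ∀ {w} (w≉0 : ¬ (w ≈ 0#)) {b₀ b₁} → code b₀ b₁ w ≈ 0# → b₀ ≈ solve-b₀ w≉0 b₁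
  solve-b₀-unique {w} w≉0 {b₀} {b₁} f≈0 = *-cancelʳ w≉0
    (trans (+-inverseˡ-unique (b₀ * w) (tailPart w b₁) (trans (sym (+-assoc _ _ _)) f≈0)) (sym (solve-b₀-* w≉0 b₁)))

  solve-b₀-cong : ∀ {w} (w≉0 : ¬ (w ≈ 0#)) {b c} → b ≈ c → solve-b₀ w≉0 b ≈ solve-b₀ w≉0 c
  solve-b₀-cong {w} w≉0 b≈c = -‿cong (*-congʳ (tailPart-cong w b≈c))

  zero⇒b₀≈0 : ∀ {w b₀ b₁} → ¬ (w ≈ 0#) → b₁ ≈ 0# → code b₀ b₁ w ≈ 0# → b₀ ≈ 0#
  zero⇒b₀≈0 {w} {b₀} {b₁} w≉0 b₁≈0 f≈0 = *-cancelʳ w≉0 (begin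
    b₀ * w                  ≈⟨ +-identityʳ _ ⟨
    b₀ * w + 0#             ≈⟨ +-congˡ (trans (tailPart-cong w b₁≈0) (tailPart-0 w)) ⟨
    b₀ * w + tailPart w b₁  ≈⟨ trans (sym (+-assoc _ _ _)) f≈0 ⟩
    0#                      ≈⟨ zeroˡ w ⟨
    0# * w                  ∎)

  scalars-enumeration : Enumeration _≈_ (λ _ → ⊤) (q ℕ.^ n)
  scalars-enumeration = record
    { elt           = from
    ; elt-∈         = λ _ → tt
    ; elt-injective = λ eq → ≡.trans (≡.sym (to-from _)) (≡.trans (to-cong _ _ eq) (to-from _))
    ; elt-onto      = λ x _ → to x , from-to x
    }

  -- A field with q^n elements has F_q-dimension n ≥ 3, which provides the three independent zeros
  -- that force b₁ = 0; one nonzero zero then forces b₀ = 0.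
  zero-code : ∀ {b₀ b₁} → (∀ x → code b₀ b₁ x ≈ 0#) → b₀ ≈ 0# × b₁ ≈ 0#
  zero-code {b₀} {b₁} zeros = fromBasis (s≤s 2≤n′) (K.hasDim ((λ _ _ _ _ → tt) , tt , (λ _ _ _ _ → tt) , λ _ _ _ _ → tt) scalars-enumeration)
    where
    -- The dimension is generalised to `m`, so that matching on the bound exposes three basis
    -- vectors.
    fromBasis : ∀ {m} → 3 ℕ.≤ m → SpK.HasDim R q (λ _ → ⊤) m → b₀ ≈ 0# × b₁ ≈ 0#
    fromBasis (s≤s (s≤s (s≤s _))) (b , _ , ind , _) = zero⇒b₀≈0 (head≉0 b ind) b₁≈0 (zeros (b 0F)) , b₁≈0
      where b₁≈0 = three-zeros⇒b₁≈0 b ind (λ i → zeros (b i))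

  code-injective : ∀ {b₀ b₁ c₀ c₁} → (∀ x → code b₀ b₁ x ≈ code c₀ c₁ x) → b₀ ≈ c₀ × b₁ ≈ c₁
  code-injective {b₀} {b₁} {c₀} {c₁} eq = restore (proj₁ difference) , restore (proj₂ difference)
    where
    restore : ∀ {a b} → a - b ≈ 0# → a ≈ b
    restore a-b≈0 = trans (transpose a-b≈0) (+-identityˡ _)
    difference : (b₀ - c₀ ≈ 0#) × (b₁ - c₁ ≈ 0#)
    difference = zero-code λ x → begin
      code (b₀ - c₀) (b₁ - c₁) x              ≈⟨ code-+ b₀ b₁ (- c₀) (- c₁) x ⟩
      code b₀ b₁ x + code (- c₀) (- c₁) x     ≈⟨ +-congʳ (eq x) ⟩
      code c₀ c₁ x + code (- c₀) (- c₁) x     ≈⟨ code-+ c₀ c₁ (- c₀) (- c₁) x ⟨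
      code (c₀ - c₀) (c₁ - c₁) x              ≈⟨ code-cong (-‿inverseʳ c₀) (-‿inverseʳ c₁) refl ⟩
      code 0# 0# x                            ≈⟨ code-0 x ⟩
      0#                                      ∎

  -- Counting the code and the codewords that vanish on U.

  infix 4 _≋_
  _≋_ : (Carrier → Carrier) → (Carrier → Carrier) → Set
  f ≋ g = ∀ x → f x ≈ g x

  S : (Carrier → Carrier) → Set
  S = InS R q n s

  S-subspace : SpFun.IsSubspace R q S
  S-subspace =
      (λ f g f≋g (b₀ , b₁ , eq) → b₀ , b₁ , λ x → trans (sym (f≋g x)) (eq x))
    , (0# , 0# , λ x → sym (code-0 x))
    , (λ f g (b₀ , b₁ , eq) (c₀ , c₁ , eq′) → b₀ + c₀ , b₁ + c₁ , λ x →
        trans (+-cong (eq x) (eq′ x)) (sym (code-+ b₀ b₁ c₀ c₁ x)))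
    , λ a f a∈F (b₀ , b₁ , eq) → a * b₀ , a * b₁ , λ x → trans (*-congˡ (eq x)) (sym (code-* a∈F b₀ b₁ x))

  S-enumeration : Enumeration _≋_ S (q ℕ.^ (n ℕ.+ n))
  S-enumeration = ≡.subst (Enumeration _≋_ S) (≡.sym (ℕ.^-distribˡ-+-* q n n)) (pairs scalars-enumeration)
    where
    pairs : ∀ {N} → Enumeration _≈_ (λ _ → ⊤) N → Enumeration _≋_ S (N ℕ.* N)
    pairs {N} A = record
      { elt           = λ k → code (A.elt (proj₁ (remQuot {N} N k))) (A.elt (proj₂ (remQuot {N} N k)))
      ; elt-∈         = λ k → _ , _ , λ x → refl
      ; elt-injective = λ {k} {l} eq → ≡.trans (≡.sym (Fin.combine-remQuot {N} N k))
          (≡.trans (≡.cong₂ combine (A.elt-injective (proj₁ (code-injective eq))) (A.elt-injective (proj₂ (code-injective eq))))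
                   (Fin.combine-remQuot {N} N l))
      ; elt-onto      = λ f (b₀ , b₁ , f≋) → let i , eq₀ = A.elt-onto b₀ tt ; j , eq₁ = A.elt-onto b₁ tt in
          combine i j , λ x → trans
            (reflexive (≡.cong (λ ij → code (A.elt (proj₁ ij)) (A.elt (proj₂ ij)) x) (Fin.remQuot-combine {N} {N} i j)))
            (trans (code-cong eq₀ eq₁ refl) (sym (f≋ x)))
      }
      where module A = Enumeration A

  module Vanishing (U : Carrier → Set) where

    Van : (Carrier → Carrier) → Set
    Van = InSVanish R q n s U

    Van-subspace : SpFun.IsSubspace R q Van
    Van-subspace =
        (λ f g f≋g (f∈S , f≈0) → proj₁ S-subspace f g f≋g f∈S , λ x x∈U → trans (sym (f≋g x)) (f≈0 x x∈U))
      , (proj₁ (proj₂ S-subspace) , λ _ _ → refl)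
      , (λ f g (f∈S , f≈0) (g∈S , g≈0) → proj₁ (proj₂ (proj₂ S-subspace)) f g f∈S g∈S
          , λ x x∈U → trans (+-cong (f≈0 x x∈U) (g≈0 x x∈U)) (+-identityʳ 0#))
      , λ a f a∈F (f∈S , f≈0) → proj₂ (proj₂ (proj₂ S-subspace)) a f a∈F f∈S
          , λ x x∈U → trans (*-congˡ (f≈0 x x∈U)) (zeroʳ a)

    -- `IsRank` is a relation, so a value must be shown both to exist and to be unique. A single
    -- count gives the first through `hasDim` and the second through `dim-unique`.
    rank-from-count : ∀ {r k} → Enumeration _≋_ Van (q ℕ.^ k) → r ℕ.+ k ≡ n ℕ.+ n →
                      IsRank R q n s U r × (∀ r′ → IsRank R q n s U r′ → r′ ≡ r)
    rank-from-count {r} {k} E r+k≡2n =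
        (n ℕ.+ n , k , Fun.hasDim S-subspace S-enumeration , Fun.hasDim Van-subspace E , r+k≡2n)
      , λ r′ (dS , dV , S-dim , Van-dim , r′+dV≡dS) → ℕ.+-cancelʳ-≡ k r′ r (≡.trans
          (≡.cong (r′ ℕ.+_) (≡.sym (Fun.dim-unique Van-subspace E Van-dim)))
          (≡.trans r′+dV≡dS (≡.trans (Fun.dim-unique S-subspace S-enumeration S-dim) (≡.sym r+k≡2n))))

    -- A codeword vanishing at b 0F is determined by b₁, so it is enough to know which values Q of b₁ occur.
    Van-enumeration : ∀ {d c} → (dim : SpK.HasDim R q U (suc d)) → (Q : Carrier → Set) →
      (∀ {b₀ b₁} → (∀ i → code b₀ b₁ (proj₁ dim i) ≈ 0#) → Q b₁) →
      (∀ {b₀ b₁} → code b₀ b₁ (proj₁ dim 0F) ≈ 0# → Q b₁ → ∀ i → code b₀ b₁ (proj₁ dim i) ≈ 0#) →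
      Enumeration _≈_ Q c → Enumeration _≋_ Van c
    Van-enumeration (b , b∈U , ind , span) Q necessary sufficient A = record
      { elt           = λ i → code (solve-b₀ b₀≉0 (A.elt i)) (A.elt i)
      ; elt-∈         = λ i → (_ , _ , λ x → refl) , λ x x∈U →
          let c , c∈F , eq = span x x∈U in trans (code-cong refl refl (sym eq))
            (code-lincomb _ _ c b c∈F (sufficient (solve-b₀-zero b₀≉0 (A.elt i)) (A.elt-∈ i)))
      ; elt-injective = λ eq → A.elt-injective (proj₂ (code-injective eq))
      ; elt-onto      = λ f ((β₀ , β₁ , f≋) , f≈0) →
          let zeros = λ i → trans (sym (f≋ (b i))) (f≈0 (b i) (b∈U i))
              i , eq = A.elt-onto β₁ (necessary zeros)
          in i , λ x → trans (code-cong (trans (solve-b₀-cong b₀≉0 eq) (sym (solve-b₀-unique b₀≉0 (zeros 0F)))) eq refl) (sym (f≋ x))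
      }
      where
      module A = Enumeration A
      b₀≉0 = head≉0 b ind

    rank₁ : SpK.HasDim R q U 1 → IsRank R q n s U n × (∀ r → IsRank R q n s U r → r ≡ n)
    rank₁ dim = rank-from-count
      (Van-enumeration dim (λ _ → ⊤) (λ _ → tt) (λ { f≈0 _ 0F → f≈0 }) scalars-enumeration) ≡.refl

    rank₂ : SpK.HasDim R q U 2 → IsRank R q n s U (2 ℕ.* n ∸ 1) × (∀ r → IsRank R q n s U r → r ≡ 2 ℕ.* n ∸ 1)
    rank₂ dim@(b , _ , ind , _) = rank-from-count
      (Van-enumeration dim (λ b₁ → Fq (b₁ * δ)) (λ zeros → zeros⇒Fq (zeros 0F) (zeros 1F))
        (λ { f≈0 _ 0F → f≈0 ; f≈0 ∈F 1F → zero-transfer (head≉0 b ind) ∈F f≈0 })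
        -- The admissible b₁ number q = q^1, so the vanishing codewords have dimension 1.
        (≡.subst (Enumeration _≈_ (λ b₁ → Fq (b₁ * δ))) (≡.sym (ℕ.*-identityʳ q)) (quotients Fq-enumeration)))
      (≡.trans (ℕ.m∸n+n≡m {2 ℕ.* n} (s≤s z≤n)) (≡.cong (n ℕ.+_) (ℕ.+-identityʳ n)))
      where
      δ = det (b 0F) (b 1F)
      δ⁻¹ = proj₁ (proj₂ isField δ (det≉0 b ind))
      divide-multiply : ∀ x → x * δ⁻¹ * δ ≈ x
      divide-multiply x = trans (*-assoc x δ⁻¹ δ)
        (trans (*-congˡ (trans (*-comm δ⁻¹ δ) (proj₂ (proj₂ isField δ (det≉0 b ind))))) (*-identityʳ x))
      -- The admissible b₁ form F_q δ⁻¹, a scaled copy of F_q.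
      quotients : ∀ {c} → Enumeration _≈_ Fq c → Enumeration _≈_ (λ b₁ → Fq (b₁ * δ)) c
      quotients A = record
        { elt           = λ i → A.elt i * δ⁻¹
        ; elt-∈         = λ i → Fq-resp (sym (divide-multiply _)) (A.elt-∈ i)
        ; elt-injective = λ eq → A.elt-injective
            (trans (sym (divide-multiply _)) (trans (*-congʳ eq) (divide-multiply _)))
        ; elt-onto      = λ x xδ∈F → let i , eq = A.elt-onto (x * δ) xδ∈F in
            i , *-cancelʳ (det≉0 b ind) (trans (divide-multiply _) eq)
        }
        where module A = Enumeration A

    rank₃ : ∀ {d} → SpK.HasDim R q U (3 ℕ.+ d) → IsRank R q n s U (2 ℕ.* n) × (∀ r → IsRank R q n s U r → r ≡ 2 ℕ.* n)
    -- Only the zero codeword vanishes on U; its count 1 = q^0 gives k = 0.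
    rank₃ dim@(b , _ , ind , _) = rank-from-count {k = 0}
      (Van-enumeration dim (_≈ 0#) (three-zeros⇒b₁≈0 b ind)
        (λ f≈0 b₁≈0 i → trans (code-cong (zero⇒b₀≈0 (head≉0 b ind) b₁≈0 f≈0) b₁≈0 refl) (code-0 (b i)))
        (record { elt = λ _ → 0# ; elt-∈ = λ _ → refl ; elt-injective = λ { {0F} {0F} _ → ≡.refl }
                ; elt-onto = λ x x≈0 → 0F , sym x≈0 }))
      (≡.trans (ℕ.+-identityʳ (2 ℕ.* n)) (≡.cong (n ℕ.+_) (ℕ.+-identityʳ n)))

open import Data.Nat using (_^_; _*_; _≤_; _<_)

theorem3p16 : (q n s : ℕ) → IsPrimePower q → 4 ≤ n → 2 ∣ n → 1 ≤ s → s ≤ n → gcd s n ≡ 1 →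
    (R : CommutativeRing 0ℓ 0ℓ) → IsField R → HasCard R (q ^ n) →
    (U : CommutativeRing.Carrier R → Set) → (u : ℕ) → 1 ≤ u →
    SpK.IsSubspace R q U → SpK.HasDim R q U u →
    (Σ ℕ λ r → IsRank R q n s U r)
    × (∀ r → IsRank R q n s U r →
         (2 < u → r ≡ 2 * n) × (u ≡ 1 → r ≡ n) × (u ≡ 2 → r ≡ 2 * n ⊎ r ≡ 2 * n Data.Nat.∸ 1))
theorem3p16 q (suc n′) s q-primePower (s≤s 3≤n′) _ _ _ gcd≡1 R isField card U u 1≤u _ dim = cases u 1≤u dim
  where
  open Code R isField q q-primePower n′ card (ℕ.≤-trans (ℕ.n≤1+n 2) 3≤n′) s gcd≡1
  open Vanishing U
  n = suc n′
  cases : ∀ u → 1 ≤ u → SpK.HasDim R q U u → (Σ ℕ λ r → IsRank R q n s U r)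
    × (∀ r → IsRank R q n s U r →
         (2 < u → r ≡ 2 * n) × (u ≡ 1 → r ≡ n) × (u ≡ 2 → r ≡ 2 * n ⊎ r ≡ 2 * n ∸ 1))
  cases 1 _ dim = (_ , proj₁ (rank₁ dim)) ,
    λ r rank → (λ { (s≤s ()) }) , (λ _ → proj₂ (rank₁ dim) r rank) , λ ()
  cases 2 _ dim = (_ , proj₁ (rank₂ dim)) ,
    λ r rank → (λ { (s≤s (s≤s ())) }) , (λ ()) , λ _ → inj₂ (proj₂ (rank₂ dim) r rank)
  cases (suc (suc (suc d))) _ dim = (_ , proj₁ (rank₃ dim)) ,
    λ r rank → (λ _ → proj₂ (rank₃ dim) r rank) , (λ ()) , λ ()
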